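{- There exists an algorithm in the hybrid setting that is given only a parameter $0<\varepsilon<1$ (and in particular has no information about $n=|U|$) and that, for every instance $(U,w)$ with $n=|U|\ge1$ and $W=\sum_{a\in U}w(a)>0$, uses in expectation $O(\sqrt n/\varepsilon)$ samples (with an absolute implied constant) and returns an estimate $\hat W$ such that, with probability at least $2/3$, $(1-\varepsilon)W\le\hat W\le(1+\varepsilon)W$.
   Context: An instance $(U,w)$ consists of a finite set $U$ and a weight function $w:U\to[0,\infty)$; $W=\sum_{a\in U}w(a)$. Hybrid setting: a (randomized, adaptive) algorithm can interact with the instance only by (1) drawing an independent proportional sample, which returns $(a,w(a))$ where item $a$ is returned with probability $w(a)/W$; (2) testing, for two sampled items $a,a'$, whether $a=a'$; (3) drawing an independent uniform sample, which returns $(a,w(a))$ where each item $a\in U$ is returned with probability $1/|U|$. The number of samples is the total number of proportional and uniform samples drawn. -}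

module Defs where

open import Algebra.Bundles using (CommutativeRing; Semiring)
open import Data.Bool.Base using (Bool; true; false; if_then_else_)
open import Data.Fin.Base using (Fin)
import Data.Fin.Properties as Fin
open import Data.Maybe.Base using (Maybe; just; nothing)
open import Data.Nat.Base using (ℕ; zero; suc)
open import Data.Product using (∃-syntax; _×_)
open import Data.Unit.Base using (⊤)
open import Data.Vec.Base using (Vec; []; _∷_; lookup)
open import Level using (0ℓ)
open import Relation.Binary.Core using (Rel)
open import Relation.Binary.Structures using (IsDecTotalOrder)
open import Relation.Nullary using (yes; does; _×-dec_)
open import Relation.Unary using (Pred; Decidable)
import Algebra.Properties.Semiring.Sum
import Algebra.Definitions.RawSemiring
import Relation.Binary.Construct.NonStrictToStrict

-- A Dedekind-complete ordered field, i.e. the classical real numbers up to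
-- isomorphism.  Decidability of the order, and the witness in `archimedean`,
-- follow from the other axioms by excluded middle; they are fields because the
-- metatheory is constructive.  The value of 0# ⁻¹ is left unspecified.
record Reals : Set₁ where
  infix  4 _≤_
  infix  8 _⁻¹
  infixl 7 _/_
  field
    commutativeRing : CommutativeRing 0ℓ 0ℓ

  open CommutativeRing commutativeRing public
    using (Carrier; _≈_; _≉_; _+_; _*_; -_; _-_; 0#; 1#)
  open CommutativeRing commutativeRing using (semiring)
  open Algebra.Properties.Semiring.Sum semiring public using (sum)
  open Algebra.Definitions.RawSemiring (Semiring.rawSemiring semiring) using () renaming (_×_ to _·_)

  fromℕ : ℕ → Carrier
  fromℕ m = m · 1#

  field
    _⁻¹             : Carrier → Carrier
    ⁻¹-inverseʳ     : ∀ {x} → x ≉ 0# → x * x ⁻¹ ≈ 1#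
    1≉0             : 1# ≉ 0#
    _≤_             : Rel Carrier 0ℓ
    isDecTotalOrder : IsDecTotalOrder _≈_ _≤_
    +-monoˡ-≤       : ∀ {x y} z → x ≤ y → x + z ≤ y + z
    *-nonNegative   : ∀ {x y} → 0# ≤ x → 0# ≤ y → 0# ≤ x * y
    archimedean     : ∀ x → ∃[ m ] x ≤ fromℕ m

  open IsDecTotalOrder isDecTotalOrder public using (_≤?_)
  open Relation.Binary.Construct.NonStrictToStrict _≈_ _≤_ public using (_<_)

  UpperBound : Pred Carrier 0ℓ → Carrier → Set
  UpperBound P u = ∀ {x} → P x → x ≤ u

  IsLub : Pred Carrier 0ℓ → Carrier → Set
  IsLub P s = UpperBound P s × (∀ u → UpperBound P u → s ≤ u)

  field
    complete : (P : Pred Carrier 0ℓ) → ∃[ x ] P x → ∃[ u ] UpperBound P u →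
               ∃[ s ] IsLub P s

  _/_ : Carrier → Carrier → Carrier
  x / y = x * y ⁻¹

  IsSup : (ℕ → Carrier) → Carrier → Set
  IsSup f = IsLub (λ x → ∃[ t ] x ≈ f t)

  IsSqrt : Carrier → Carrier → Set
  IsSqrt x r = 0# ≤ r × r * r ≈ x

module Hybrid (ℝ : Reals) where
  open Reals ℝ

  record Instance : Set where
    field
      size     : ℕ
      w        : Fin size → Carrier
      w-nonNeg : ∀ a → 0# ≤ w a

    W : Carrier
    W = sum w

  -- What to do after k samples.  Both kinds of sample reveal the weight of the
  -- drawn item; the item itself is visible only through `test i j`, which asks
  -- whether two of the k samples drawn so far are the same item.
  data Action (State : ℕ → Set) (k : ℕ) : Set where
    return       : Carrier → Action State k
    proportional : (Carrier → State (suc k)) → Action State k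
    uniform      : (Carrier → State (suc k)) → Action State k
    test         : Fin k → Fin k → (Bool → State k) → Action State k
    coin         : (Bool → State k) → Action State k

  record Algorithm : Set₁ where
    field
      State : ℕ → Set
      start : State 0
      step  : ∀ {k} → State k → Action State k

  module Run (A : Algorithm) (I : Instance) where
    open Algorithm A
    open Instance I

    -- `expect g t items s` is the expectation of g (number of samples drawn)
    -- (value returned, if any) after t further steps from state s, where
    -- `items` are the items drawn so far, the most recent one at index zero.
    expect : (ℕ → Maybe Carrier → Carrier) → ℕ →
             ∀ {k} → Vec (Fin size) k → State k → Carrier
    expect g zero    {k} items s = g k nothing
    expect g (suc t) {k} items s with step s
    ... | return x       = g k (just x)
    ... | proportional c = sum λ a → (w a / W) * expect g t (a ∷ items) (c (w a))
    ... | uniform c      = sum λ a → (1# / fromℕ size) * expect g t (a ∷ items) (c (w a))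
    ... | test i j c     =
      expect g t items (c (does (lookup items i Fin.≟ lookup items j)))
    ... | coin c         =
      (1# / fromℕ 2) * expect g t items (c true) +
      (1# / fromℕ 2) * expect g t items (c false)

    indicator : {P : Pred Carrier 0ℓ} → Decidable P → ℕ → Maybe Carrier → Carrier
    indicator P? k nothing  = 0#
    indicator P? k (just x) = if does (P? x) then 1# else 0#

    -- The quantities for runs cut off after t steps increase with t, so by
    -- monotone convergence their supremum is the value for the full run.
    ExpectedSamples : Carrier → Set
    ExpectedSamples = IsSup λ t → expect (λ k _ → fromℕ k) t [] start

    ProbReturns : {P : Pred Carrier 0ℓ} → Decidable P → Carrier → Set
    ProbReturns P? = IsSup λ t → expect (indicator P?) t [] start

    TerminatesAlmostSurely : Set
    TerminatesAlmostSurely = ProbReturns {λ _ → ⊤} (λ _ → yes _) 1#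

  module _ (ε : Carrier) (I : Instance) where
    open Instance I

    Accurate : Pred Carrier 0ℓ
    Accurate Ŵ = (1# - ε) * W ≤ Ŵ × Ŵ ≤ (1# + ε) * W

    accurate? : Decidable Accurate
    accurate? Ŵ = ((1# - ε) * W ≤? Ŵ) ×-dec (Ŵ ≤? (1# + ε) * W)

{-# OPTIONS --safe #-}

-- Draw uniform samples until one item repeats, after K samples, and then draw
-- m = 28 ⌈1/ε⌉ K proportional samples a₁, …, aₘ.  The statistic
-- S = Σ_{i<j} [aᵢ = aⱼ] / w(aᵢ) has mean C(m,2) / W, because a new sample
-- coincides with the earlier aᵢ with probability w(aᵢ) / W.  For the same
-- reason the increments of S are martingale differences after centring, which
-- gives Var S ≤ C(m,2) n / W², so by Chebyshev C(m,2) / S is accurate with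
-- probability at least 11/12 once 2K ≥ √n.  A birthday argument shows that
-- 2K < √n has probability at most 1/4 and that E[K] = O(√n).
--
-- All expectations are bounded by potentials: a function of the state which
-- does not increase in expectation at any step and dominates the quantity of
-- interest at the end.  As K ≤ n + 1, for each instance the algorithm halts
-- within a fixed number of steps, so every supremum over cut-offs is attained.

module Submission where

open import Defs
open import Algebra.Bundles using (CommutativeRing; RawRing)
import Algebra.Properties.Ring
import Algebra.Properties.Semiring.Mult
import Algebra.Properties.Semiring.Sum
import Algebra.Solver.Ring
open import Algebra.Solver.Ring.AlmostCommutativeRing
  using (fromCommutativeRing; _-Raw-AlmostCommutative⟶_)
open import Data.Bool.Base using (Bool; true; false; if_then_else_)
open import Data.Fin.Base using (Fin; zero; suc; _↑ˡ_)
import Data.Fin.Properties as Fin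
open import Data.Integer.Base as ℤ using (ℤ; +_; -[1+_]; _⊖_; _◃_)
import Data.Integer.Properties as ℤ
open import Data.Maybe.Base using (Maybe; just; nothing)
open import Data.Nat.Base as ℕ using (ℕ; zero; suc) renaming (_≤_ to _≤ℕ_)
import Data.Nat.Properties as ℕ
open import Data.Product using (Σ-syntax; ∃-syntax; _×_; _,_; proj₁; proj₂)
import Data.Sign.Base as Sign
open import Data.Sum.Base using (_⊎_; inj₁; inj₂; [_,_]′)
open import Data.Unit.Base using (⊤)
open import Data.Vec.Base using (Vec; []; _∷_; lookup)
open import Function.Base using (_∘_; id)
open import Function.Definitions using (Injective)
open import Level using (0ℓ)
open import Relation.Binary.Bundles using (Poset)
open import Relation.Binary.PropositionalEquality as ≡ using (_≡_; _≢_)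
import Relation.Binary.Reasoning.PartialOrder
import Relation.Binary.Reasoning.Setoid
open import Relation.Binary.Structures using (IsDecTotalOrder)
open import Relation.Nullary using (¬_; Dec; does; yes; no; contradiction)
open import Relation.Unary using (Pred; Decidable)

-- The motive `Q` is explicit, so a goal can be split at one chosen conditional without abstracting
-- over `P?` by `with`.
if-does : ∀ {A P : Set} (P? : Dec P) (Q : A → Set) {x y : A} → (P → Q x) → (¬ P → Q y) → Q (if does P? then x else y)
if-does (yes p) Q Qx Qy = Qx p
if-does (no ¬p) Q Qx Qy = Qy ¬p

-- A ring solver with integer coefficients.

module IntegerCoefficients {c ℓ} (R : CommutativeRing c ℓ) where
  open CommutativeRing R
  open Algebra.Properties.Semiring.Mult semiring using (×1-homo-*; ×-homo-+) renaming (_×_ to _·_)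
  open Algebra.Properties.Ring ring using (-‿involutive; -‿distribˡ-*; -‿distribʳ-*; -0#≈0#; -‿+-comm)
  open Relation.Binary.Reasoning.Setoid setoid

  fromℤ : ℤ → Carrier
  fromℤ (+ n)    = n · 1#
  fromℤ -[1+ n ] = - (suc n · 1#)

  fromℤ-neg : ∀ i → fromℤ (ℤ.- i) ≈ - fromℤ i
  fromℤ-neg (+ zero)  = sym -0#≈0#
  fromℤ-neg (+ suc n) = refl
  fromℤ-neg -[1+ n ]  = sym (-‿involutive _)

  private
    cancel-1 : ∀ x y → x - y ≈ (1# + x) - (1# + y)
    cancel-1 x y = begin
      x - y                      ≈⟨ +-congˡ (+-identityˡ (- y)) ⟨
      x + (0# - y)               ≈⟨ +-congˡ (+-congʳ (-‿inverseʳ 1#)) ⟨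
      x + ((1# - 1#) - y)        ≈⟨ +-congˡ (+-assoc 1# (- 1#) (- y)) ⟩
      x + (1# + (- 1# - y))      ≈⟨ +-assoc x 1# _ ⟨
      (x + 1#) + (- 1# - y)      ≈⟨ +-cong (+-comm x 1#) (-‿+-comm 1# y) ⟩
      (1# + x) - (1# + y)        ∎

  fromℤ-⊖ : ∀ m n → fromℤ (m ⊖ n) ≈ m · 1# - n · 1#
  fromℤ-⊖ m zero = begin
    m · 1#       ≈⟨ +-identityʳ _ ⟨
    m · 1# + 0#  ≈⟨ +-congˡ -0#≈0# ⟨
    m · 1# - 0#  ∎
  fromℤ-⊖ zero (suc n)    = sym (+-identityˡ _)
  fromℤ-⊖ (suc m) (suc n) = begin
    fromℤ (suc m ⊖ suc n)      ≡⟨ ≡.cong fromℤ (ℤ.[1+m]⊖[1+n]≡m⊖n m n) ⟩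
    fromℤ (m ⊖ n)              ≈⟨ fromℤ-⊖ m n ⟩
    m · 1# - n · 1#            ≈⟨ cancel-1 _ _ ⟩
    suc m · 1# - suc n · 1#    ∎

  fromℤ-+ : ∀ i j → fromℤ (i ℤ.+ j) ≈ fromℤ i + fromℤ j
  fromℤ-+ (+ m) (+ n)       = ×-homo-+ 1# m n
  fromℤ-+ (+ m) -[1+ n ]    = fromℤ-⊖ m (suc n)
  fromℤ-+ -[1+ m ] (+ n)    = trans (fromℤ-⊖ n (suc m)) (+-comm _ _)
  fromℤ-+ -[1+ m ] -[1+ n ] = begin
    - (suc (suc (m ℕ.+ n)) · 1#)       ≡⟨ ≡.cong (λ k → - (suc k · 1#)) (ℕ.+-suc m n) ⟨
    - ((suc m ℕ.+ suc n) · 1#)         ≈⟨ -‿cong (×-homo-+ 1# (suc m) (suc n)) ⟩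
    - (suc m · 1# + suc n · 1#)        ≈⟨ -‿+-comm _ _ ⟨
    - (suc m · 1#) - (suc n · 1#)      ∎

  fromℤ-* : ∀ i j → fromℤ (i ℤ.* j) ≈ fromℤ i * fromℤ j
  fromℤ-* (+ m) (+ n) = begin
    fromℤ (Sign.+ ◃ m ℕ.* n)     ≡⟨ ≡.cong fromℤ (ℤ.+◃n≡+n (m ℕ.* n)) ⟩
    (m ℕ.* n) · 1#               ≈⟨ ×1-homo-* m n ⟩
    (m · 1#) * (n · 1#)          ∎
  fromℤ-* (+ m) -[1+ n ] = begin
    fromℤ (Sign.- ◃ m ℕ.* suc n)     ≡⟨ ≡.cong fromℤ (ℤ.-◃n≡-n (m ℕ.* suc n)) ⟩
    fromℤ (ℤ.- + (m ℕ.* suc n))      ≈⟨ fromℤ-neg (+ (m ℕ.* suc n)) ⟩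
    - ((m ℕ.* suc n) · 1#)           ≈⟨ -‿cong (×1-homo-* m (suc n)) ⟩
    - ((m · 1#) * (suc n · 1#))      ≈⟨ -‿distribʳ-* _ _ ⟩
    (m · 1#) * - (suc n · 1#)        ∎
  fromℤ-* -[1+ m ] (+ n) = begin
    fromℤ (Sign.- ◃ suc m ℕ.* n)     ≡⟨ ≡.cong fromℤ (ℤ.-◃n≡-n (suc m ℕ.* n)) ⟩
    fromℤ (ℤ.- + (suc m ℕ.* n))      ≈⟨ fromℤ-neg (+ (suc m ℕ.* n)) ⟩
    - ((suc m ℕ.* n) · 1#)           ≈⟨ -‿cong (×1-homo-* (suc m) n) ⟩
    - ((suc m · 1#) * (n · 1#))      ≈⟨ -‿distribˡ-* _ _ ⟩
    - (suc m · 1#) * (n · 1#)        ∎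
  fromℤ-* -[1+ m ] -[1+ n ] = begin
    (suc m ℕ.* suc n) · 1#           ≈⟨ ×1-homo-* (suc m) (suc n) ⟩
    a * b                            ≈⟨ -‿involutive _ ⟨
    - - (a * b)                      ≈⟨ -‿cong (-‿distribˡ-* _ _) ⟩
    - (- a * b)                      ≈⟨ -‿distribʳ-* _ _ ⟩
    - a * - b                        ∎
    where
    a = suc m · 1#
    b = suc n · 1#

  -- Interpreting the coefficient 1 as 1# itself, and not as 1# + 0#, lets the
  -- solver recognise a literal 1# in a goal.
  ⟦_⟧ᶜ : ℤ → Carrier
  ⟦ + 1 ⟧ᶜ = 1#
  ⟦ i   ⟧ᶜ = fromℤ i

  ⟦⟧ᶜ≈fromℤ : ∀ i → ⟦ i ⟧ᶜ ≈ fromℤ i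
  ⟦⟧ᶜ≈fromℤ (+ zero)        = refl
  ⟦⟧ᶜ≈fromℤ (+ suc zero)    = sym (+-identityʳ 1#)
  ⟦⟧ᶜ≈fromℤ (+ suc (suc n)) = refl
  ⟦⟧ᶜ≈fromℤ -[1+ n ]        = refl

  ℤ-rawRing : RawRing 0ℓ 0ℓ
  ℤ-rawRing = record
    { Carrier = ℤ ; _≈_ = _≡_ ; _+_ = ℤ._+_ ; _*_ = ℤ._*_ ; -_ = ℤ.-_ ; 0# = ℤ.0ℤ ; 1# = ℤ.1ℤ }

  ⟦⟧ᶜ-morphism : ℤ-rawRing -Raw-AlmostCommutative⟶ fromCommutativeRing R
  ⟦⟧ᶜ-morphism = record
    { ⟦_⟧    = ⟦_⟧ᶜ
    ; +-homo = λ i j → trans (⟦⟧ᶜ≈fromℤ (i ℤ.+ j)) (trans (fromℤ-+ i j) (sym (+-cong (⟦⟧ᶜ≈fromℤ i) (⟦⟧ᶜ≈fromℤ j))))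
    ; *-homo = λ i j → trans (⟦⟧ᶜ≈fromℤ (i ℤ.* j)) (trans (fromℤ-* i j) (sym (*-cong (⟦⟧ᶜ≈fromℤ i) (⟦⟧ᶜ≈fromℤ j))))
    ; -‿homo = λ i → trans (⟦⟧ᶜ≈fromℤ (ℤ.- i)) (trans (fromℤ-neg i) (-‿cong (sym (⟦⟧ᶜ≈fromℤ i))))
    ; 0-homo = refl
    ; 1-homo = refl
    }

  _coeff≟_ : ∀ i j → Maybe (⟦ i ⟧ᶜ ≈ ⟦ j ⟧ᶜ)
  i coeff≟ j with i ℤ.≟ j
  ... | yes i≡j = just (reflexive (≡.cong ⟦_⟧ᶜ i≡j))
  ... | no  _   = nothing

  open Algebra.Solver.Ring ℤ-rawRing (fromCommutativeRing R) ⟦⟧ᶜ-morphism _coeff≟_ public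

-- Arithmetic in an ordered field.

module OrderedField (ℝ : Reals) where
  open Reals ℝ public
  open CommutativeRing commutativeRing public
    using ( refl; sym; trans; reflexive; setoid; semiring
          ; +-cong; +-congˡ; +-congʳ; *-cong; *-congˡ; *-congʳ; -‿cong
          ; +-comm; +-assoc; *-comm; *-assoc; +-identityˡ; +-identityʳ; *-identityˡ; *-identityʳ
          ; zeroˡ; zeroʳ; distribˡ; distribʳ; -‿inverseʳ )
  open IsDecTotalOrder isDecTotalOrder public
    using (antisym; total; isPartialOrder)
    renaming (refl to ≤-refl; reflexive to ≤-reflexive; trans to ≤-trans)
  open IntegerCoefficients commutativeRing public
    using (solve; _:=_; _:+_; _:*_; _:-_; :-_; con)
  open Algebra.Properties.Semiring.Mult semiring using (×1-homo-*; ×-homo-+)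

  poset : Poset 0ℓ 0ℓ 0ℓ
  poset = record { isPartialOrder = isPartialOrder }

  module ≤-Reasoning = Relation.Binary.Reasoning.PartialOrder poset
  module ≈-Reasoning = Relation.Binary.Reasoning.Setoid setoid

  ≤-respˡ : ∀ {x y z} → x ≈ y → x ≤ z → y ≤ z
  ≤-respˡ x≈y = ≤-trans (≤-reflexive (sym x≈y))

  ≤-respʳ : ∀ {x y z} → x ≈ y → z ≤ x → z ≤ y
  ≤-respʳ x≈y z≤x = ≤-trans z≤x (≤-reflexive x≈y)

  ≰⇒≥ : ∀ {x y} → ¬ (x ≤ y) → y ≤ x
  ≰⇒≥ {x} {y} x≰y with total x y
  ... | inj₁ x≤y = contradiction x≤y x≰y
  ... | inj₂ y≤x = y≤x

  <⇒≱ : ∀ {x y} → x < y → ¬ (y ≤ x)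
  <⇒≱ (x≤y , x≉y) y≤x = x≉y (antisym x≤y y≤x)

  ≰⇒> : ∀ {x y} → ¬ (x ≤ y) → y < x
  ≰⇒> x≰y = ≰⇒≥ x≰y , λ y≈x → x≰y (≤-reflexive (sym y≈x))

  <⇒≉ : ∀ {x} → 0# < x → x ≉ 0#
  <⇒≉ (_ , 0≉x) x≈0 = 0≉x (sym x≈0)

  +-mono-≤ : ∀ {a b c d} → a ≤ b → c ≤ d → a + c ≤ b + d
  +-mono-≤ {a} {b} {c} {d} a≤b c≤d = begin
    a + c  ≤⟨ +-monoˡ-≤ c a≤b ⟩
    b + c  ≈⟨ +-comm b c ⟩
    c + b  ≤⟨ +-monoˡ-≤ b c≤d ⟩
    d + b  ≈⟨ +-comm d b ⟩
    b + d  ∎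
    where open ≤-Reasoning

  +-nonNegative : ∀ {x y} → 0# ≤ x → 0# ≤ y → 0# ≤ x + y
  +-nonNegative 0≤x 0≤y = ≤-respˡ (+-identityˡ 0#) (+-mono-≤ 0≤x 0≤y)

  x≤y⇒0≤y-x : ∀ {x y} → x ≤ y → 0# ≤ y - x
  x≤y⇒0≤y-x {x} x≤y = ≤-respˡ (-‿inverseʳ x) (+-monoˡ-≤ (- x) x≤y)

  -- The second argument is usually left to the ring solver, after exhibiting
  -- y - x as an expression d built from nonnegative terms.
  ≤-by : ∀ {x y d} → 0# ≤ d → y ≈ x + d → x ≤ y
  ≤-by {x} {y} {d} 0≤d y≈x+d = begin
    x       ≈⟨ +-identityʳ x ⟨
    x + 0#  ≤⟨ +-mono-≤ ≤-refl 0≤d ⟩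
    x + d   ≈⟨ y≈x+d ⟨
    y       ∎
    where open ≤-Reasoning

  *-monoˡ-≤ : ∀ {x y z} → 0# ≤ x → y ≤ z → x * y ≤ x * z
  *-monoˡ-≤ {x} {y} {z} 0≤x y≤z = ≤-by (*-nonNegative 0≤x (x≤y⇒0≤y-x y≤z))
    (solve 3 (λ x y z → x :* z := x :* y :+ x :* (z :- y)) refl x y z)

  *-mono-≤ : ∀ {a b c d} → 0# ≤ a → 0# ≤ c → a ≤ b → c ≤ d → a * c ≤ b * d
  *-mono-≤ {a} {b} {c} {d} 0≤a 0≤c a≤b c≤d = begin
    a * c  ≤⟨ *-monoˡ-≤ 0≤a c≤d ⟩
    a * d  ≈⟨ *-comm a d ⟩
    d * a  ≤⟨ *-monoˡ-≤ (≤-trans 0≤c c≤d) a≤b ⟩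
    d * b  ≈⟨ *-comm d b ⟩
    b * d  ∎
    where open ≤-Reasoning

  neg-nonNegative : ∀ {x} → x ≤ 0# → 0# ≤ - x
  neg-nonNegative {x} x≤0 = ≤-respʳ (+-identityˡ (- x)) (x≤y⇒0≤y-x x≤0)

  square-nonNegative : ∀ x → 0# ≤ x * x
  square-nonNegative x with total 0# x
  ... | inj₁ 0≤x = *-nonNegative 0≤x 0≤x
  ... | inj₂ x≤0 = ≤-respʳ (solve 1 (λ x → (:- x) :* (:- x) := x :* x) refl x)
                     (*-nonNegative (neg-nonNegative x≤0) (neg-nonNegative x≤0))

  0≤1 : 0# ≤ 1#
  0≤1 = ≤-respʳ (*-identityˡ 1#) (square-nonNegative 1#)

  0<1 : 0# < 1#
  0<1 = 0≤1 , λ 0≈1 → 1≉0 (sym 0≈1)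

  <-≤-trans : ∀ {x y z} → x < y → y ≤ z → x < z
  <-≤-trans x<y y≤z = ≰⇒> λ z≤x → <⇒≱ x<y (≤-trans y≤z z≤x)

  fromℕ-+ : ∀ m n → fromℕ (m ℕ.+ n) ≈ fromℕ m + fromℕ n
  fromℕ-+ = ×-homo-+ 1#

  fromℕ-* : ∀ m n → fromℕ (m ℕ.* n) ≈ fromℕ m * fromℕ n
  fromℕ-* = ×1-homo-*

  0≤fromℕ : ∀ n → 0# ≤ fromℕ n
  0≤fromℕ zero    = ≤-refl
  0≤fromℕ (suc n) = +-nonNegative 0≤1 (0≤fromℕ n)

  fromℕ-mono-≤ : ∀ {m n} → m ℕ.≤ n → fromℕ m ≤ fromℕ n
  fromℕ-mono-≤ {n = n} ℕ.z≤n = 0≤fromℕ n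
  fromℕ-mono-≤ (ℕ.s≤s m≤n)   = +-mono-≤ ≤-refl (fromℕ-mono-≤ m≤n)

  1≤fromℕ-suc : ∀ n → 1# ≤ fromℕ (suc n)
  1≤fromℕ-suc n = ≤-by (0≤fromℕ n) refl

  0<fromℕ-suc : ∀ n → 0# < fromℕ (suc n)
  0<fromℕ-suc n = <-≤-trans 0<1 (1≤fromℕ-suc n)

  *-positive : ∀ {x y} → 0# < x → 0# < y → 0# < x * y
  *-positive {x} {y} 0<x@(0≤x , _) (0≤y , 0≉y) = *-nonNegative 0≤x 0≤y , λ 0≈xy → 0≉y (begin
    0#               ≈⟨ zeroʳ (x ⁻¹) ⟨
    x ⁻¹ * 0#        ≈⟨ *-congˡ 0≈xy ⟩
    x ⁻¹ * (x * y)   ≈⟨ solve 3 (λ x i y → i :* (x :* y) := (x :* i) :* y) refl x (x ⁻¹) y ⟩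
    (x * x ⁻¹) * y   ≈⟨ *-congʳ (⁻¹-inverseʳ (<⇒≉ 0<x)) ⟩
    1# * y           ≈⟨ *-identityˡ y ⟩
    y                ∎)
    where open ≈-Reasoning

  ⁻¹-nonNegative : ∀ {x} → 0# < x → 0# ≤ x ⁻¹
  ⁻¹-nonNegative {x} 0<x = ≤-respʳ
    (begin
      x * (x ⁻¹ * x ⁻¹)   ≈⟨ *-assoc x (x ⁻¹) (x ⁻¹) ⟨
      (x * x ⁻¹) * x ⁻¹   ≈⟨ *-congʳ (⁻¹-inverseʳ (<⇒≉ 0<x)) ⟩
      1# * x ⁻¹           ≈⟨ *-identityˡ (x ⁻¹) ⟩
      x ⁻¹                ∎)
    (*-nonNegative (proj₁ 0<x) (square-nonNegative (x ⁻¹)))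
    where open ≈-Reasoning

  *-cancelˡ-≤ : ∀ {x y z} → 0# < x → x * y ≤ x * z → y ≤ z
  *-cancelˡ-≤ {x} {y} {z} 0<x xy≤xz = begin
    y                ≈⟨ cancel y ⟨
    x ⁻¹ * (x * y)   ≤⟨ *-monoˡ-≤ (⁻¹-nonNegative 0<x) xy≤xz ⟩
    x ⁻¹ * (x * z)   ≈⟨ cancel z ⟩
    z                ∎
    where
    open ≤-Reasoning
    cancel : ∀ y → x ⁻¹ * (x * y) ≈ y
    cancel y = trans (solve 3 (λ x i y → i :* (x :* y) := (x :* i) :* y) refl x (x ⁻¹) y)
                 (trans (*-congʳ (⁻¹-inverseʳ (<⇒≉ 0<x))) (*-identityˡ y))

  x/y*y≈x : ∀ {x y} → 0# < y → (x / y) * y ≈ x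
  x/y*y≈x {x} {y} 0<y = begin
    (x * y ⁻¹) * y   ≈⟨ solve 3 (λ x i y → (x :* i) :* y := x :* (y :* i)) refl x (y ⁻¹) y ⟩
    x * (y * y ⁻¹)   ≈⟨ *-congˡ (⁻¹-inverseʳ (<⇒≉ 0<y)) ⟩
    x * 1#           ≈⟨ *-identityʳ x ⟩
    x                ∎
    where open ≈-Reasoning

  ≤-/ : ∀ {x y z} → 0# < y → x * y ≤ z → x ≤ z / y
  ≤-/ {x} {y} {z} 0<y xy≤z = *-cancelˡ-≤ 0<y (≤-respˡ (*-comm x y) (≤-respʳ (trans (sym (x/y*y≈x 0<y)) (*-comm _ y)) xy≤z))

  /-≤ : ∀ {x y z} → 0# < y → x ≤ z * y → x / y ≤ z
  /-≤ {x} {y} {z} 0<y x≤zy = *-cancelˡ-≤ 0<y (≤-respˡ (trans (sym (x/y*y≈x 0<y)) (*-comm _ y)) (≤-respʳ (*-comm z y) x≤zy))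

  -- If `x` exceeded `y`, then `x + y` would be positive and could be cancelled in y² - x² = (x +
  -- y)(y - x).
  square-cancel-≤ : ∀ {x y} → 0# ≤ y → x * x ≤ y * y → x ≤ y
  square-cancel-≤ {x} {y} 0≤y xx≤yy with x ≤? y
  ... | yes x≤y = x≤y
  ... | no  x≰y = contradiction (*-cancelˡ-≤ 0<x+y (≤-by (x≤y⇒0≤y-x xx≤yy)
      (solve 2 (λ x y → (x :+ y) :* y := (x :+ y) :* x :+ (y :* y :- x :* x)) refl x y))) x≰y
    where
    0<x : 0# < x
    0<x = ≰⇒> λ x≤0 → <⇒≱ (≰⇒> x≰y) (≤-trans x≤0 0≤y)
    0<x+y : 0# < x + y
    0<x+y = <-≤-trans 0<x (≤-by 0≤y refl)

  -- Descend from an Archimedean bound as long as it remains a bound. The descent may bottom out at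
  -- zero, where a very negative `x` violates `m ≤ x + 1`; hence the disjunction.
  ceiling : ∀ x → ∃[ m ] x ≤ fromℕ m × (m ≡ 0 ⊎ fromℕ m ≤ x + 1#)
  ceiling x = let m , x≤m = archimedean x in descend m x≤m
    where
    descend : ∀ m → x ≤ fromℕ m → ∃[ m ] x ≤ fromℕ m × (m ≡ 0 ⊎ fromℕ m ≤ x + 1#)
    descend zero    x≤0   = 0 , x≤0 , inj₁ ≡.refl
    descend (suc m) x≤1+m with x ≤? fromℕ m
    ... | yes x≤m = descend m x≤m
    ... | no  x≰m = suc m , x≤1+m , inj₂ (≤-respˡ (+-comm (fromℕ m) 1#) (+-monoˡ-≤ 1# (≰⇒≥ x≰m)))

  infixl 6 _⊔_
  _⊔_ : Carrier → Carrier → Carrier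
  x ⊔ y = if does (x ≤? y) then y else x

  x≤y⇒x⊔y≈y : ∀ {x y} → x ≤ y → x ⊔ y ≈ y
  x≤y⇒x⊔y≈y {x} {y} x≤y = if-does (x ≤? y) (_≈ y) (λ _ → refl) (contradiction x≤y)

  y≤x⇒x⊔y≈x : ∀ {x y} → y ≤ x → x ⊔ y ≈ x
  y≤x⇒x⊔y≈x {x} {y} y≤x = if-does (x ≤? y) (_≈ x) (antisym y≤x) (λ _ → refl)

  x≤x⊔y : ∀ x y → x ≤ x ⊔ y
  x≤x⊔y x y = if-does (x ≤? y) (x ≤_) (λ x≤y → x≤y) (λ _ → ≤-refl)

  y≤x⊔y : ∀ x y → y ≤ x ⊔ y
  y≤x⊔y x y = if-does (x ≤? y) (y ≤_) (λ _ → ≤-refl) ≰⇒≥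

  ⊔-lub : ∀ {x y z} → x ≤ z → y ≤ z → x ⊔ y ≤ z
  ⊔-lub {x} {y} {z} x≤z y≤z = if-does (x ≤? y) (_≤ z) (λ _ → y≤z) (λ _ → x≤z)

-- Square roots from Dedekind completeness.

module SquareRoot (ℝ : Reals) where
  open OrderedField ℝ

  -- Here `y` is the quotient `e / d`; stating this as a product keeps inverses away from the ring
  -- solver.
  square-*-≤ : ∀ {y d e z} → 0# < d → y * d ≈ e → e * e ≤ z * (d * d) → y * y ≤ z
  square-*-≤ {y} {d} {e} {z} 0<d yd≈e ee≤zdd = *-cancelˡ-≤ (*-positive 0<d 0<d) (begin
    (d * d) * (y * y)   ≈⟨ solve 2 (λ y d → (d :* d) :* (y :* y) := (y :* d) :* (y :* d)) refl y d ⟩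
    (y * d) * (y * d)   ≈⟨ *-cong yd≈e yd≈e ⟩
    e * e               ≤⟨ ee≤zdd ⟩
    z * (d * d)         ≈⟨ *-comm z (d * d) ⟩
    (d * d) * z         ∎)
    where open ≤-Reasoning

  -- If s were not a square root of x, then either the harmonic or the
  -- arithmetic mean of s and x / s would contradict that s is the supremum.
  sqrt : ∀ x → 1# ≤ x → ∃[ r ] IsSqrt x r × 1# ≤ r
  sqrt x 1≤x = s , (0≤s , antisym ss≤x x≤ss) , 1≤s
    where
    Root : Carrier → Set
    Root y = y * y ≤ x

    0<x : 0# < x
    0<x = <-≤-trans 0<1 1≤x

    bounded : UpperBound Root x
    bounded yy≤x = square-cancel-≤ (proj₁ 0<x)
      (≤-trans yy≤x (≤-respˡ (*-identityʳ x) (*-monoˡ-≤ (proj₁ 0<x) 1≤x)))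

    lub : ∃[ s ] IsLub Root s
    lub = complete Root (1# , ≤-respˡ (sym (*-identityʳ 1#)) 1≤x) (x , bounded)

    s : Carrier
    s = proj₁ lub

    1≤s : 1# ≤ s
    1≤s = proj₁ (proj₂ lub) (≤-respˡ (sym (*-identityʳ 1#)) 1≤x)

    0<s : 0# < s
    0<s = <-≤-trans 0<1 1≤s

    0≤s : 0# ≤ s
    0≤s = proj₁ 0<s

    x≤ss : x ≤ s * s
    x≤ss = *-cancelˡ-≤ 0<s (≤-by (x≤y⇒0≤y-x sum≤) (solve 2 (λ s x →
        s :* (s :* s) := s :* x :+ (s :* (s :* s :+ x) :- con (+ 2) :* (x :* s))) refl s x))
      where
      -- The harmonic mean `y` has square at most `x`, so `y ≤ s`, which rearranges to `x ≤ s * s`.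
      d = s * s + x
      e = fromℕ 2 * (x * s)
      y = e / d
      0<d : 0# < d
      0<d = <-≤-trans (*-positive 0<s 0<s) (≤-by (proj₁ 0<x) refl)
      yy≤x : y * y ≤ x
      yy≤x = square-*-≤ 0<d (x/y*y≈x 0<d) (≤-by
        (*-nonNegative (proj₁ 0<x) (square-nonNegative (s * s - x)))
        (solve 2 (λ s x → x :* ((s :* s :+ x) :* (s :* s :+ x)) :=
          (con (+ 2) :* (x :* s)) :* (con (+ 2) :* (x :* s)) :+ x :* ((s :* s :- x) :* (s :* s :- x))) refl s x))
      sum≤ : e ≤ s * d
      sum≤ = ≤-respˡ (trans (*-comm d y) (x/y*y≈x 0<d)) (≤-respʳ (*-comm d s)
               (*-monoˡ-≤ (proj₁ 0<d) (proj₁ (proj₂ lub) yy≤x)))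

    ss≤x : s * s ≤ x
    ss≤x = ≤-by (x≤y⇒0≤y-x s*d≤e) (solve 2 (λ s x →
        x := s :* s :+ ((s :* s :+ x) :- s :* (con (+ 2) :* s))) refl s x)
      where
      -- The arithmetic mean `y` has square at least `x`, so it bounds `Root` from above and
      -- `s ≤ y`.
      d = fromℕ 2 * s
      e = s * s + x
      y = e / d
      0<d : 0# < d
      0<d = *-positive (0<fromℕ-suc 1) 0<s
      0≤y : 0# ≤ y
      0≤y = *-nonNegative (+-nonNegative (square-nonNegative s) (proj₁ 0<x)) (⁻¹-nonNegative 0<d)
      x≤yy : x ≤ y * y
      x≤yy = *-cancelˡ-≤ (*-positive 0<d 0<d) (begin
        (d * d) * x         ≤⟨ ≤-by (square-nonNegative (s * s - x)) (solve 2 (λ s x →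
          (s :* s :+ x) :* (s :* s :+ x) := ((con (+ 2) :* s) :* (con (+ 2) :* s)) :* x :+ (s :* s :- x) :* (s :* s :- x)) refl s x) ⟩
        e * e               ≈⟨ *-cong (x/y*y≈x 0<d) (x/y*y≈x 0<d) ⟨
        (y * d) * (y * d)   ≈⟨ solve 2 (λ y d → (y :* d) :* (y :* d) := (d :* d) :* (y :* y)) refl y d ⟩
        (d * d) * (y * y)   ∎)
        where open ≤-Reasoning
      s*d≤e : s * d ≤ e
      s*d≤e = ≤-respˡ (*-comm d s) (≤-respʳ (trans (*-comm d y) (x/y*y≈x 0<d))
                (*-monoˡ-≤ (proj₁ 0<d) (proj₂ (proj₂ lub) y λ zz≤x → square-cancel-≤ 0≤y (≤-trans zz≤x x≤yy))))

-- Finite sums and counts of occurrences.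

module FiniteSums (ℝ : Reals) where
  open OrderedField ℝ
  open Algebra.Properties.Semiring.Sum semiring public
    using (sum-cong-≋; ∑-distrib-+; ∑-comm; *-distribˡ-sum; *-distribʳ-sum; sum-replicate-zero)

  sum-mono-≤ : ∀ {n} {f g : Fin n → Carrier} → (∀ i → f i ≤ g i) → sum f ≤ sum g
  sum-mono-≤ {zero}  f≤g = ≤-refl
  sum-mono-≤ {suc n} f≤g = +-mono-≤ (f≤g zero) (sum-mono-≤ (f≤g ∘ suc))

  sum-const : ∀ n x → sum {n} (λ _ → x) ≈ fromℕ n * x
  sum-const zero    x = sym (zeroˡ x)
  sum-const (suc n) x = trans (+-congˡ (sum-const n x))
    (solve 2 (λ m x → x :+ m :* x := (con (+ 1) :+ m) :* x) refl (fromℕ n) x)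

  average : ∀ {n} (p : Fin n → Carrier) x → sum p ≈ 1# → sum (λ a → p a * x) ≈ x
  average p x Σp≈1 = trans (sym (*-distribʳ-sum x p)) (trans (*-congʳ Σp≈1) (*-identityˡ x))

  -- The summand has the shape that the second-moment potential takes after one more draw, with `y`
  -- the square of `x`.
  sum-linear : ∀ {n} (p x y z : Fin n → Carrier) A B C →
    sum (λ a → p a * (A + B * x a + y a + C * z a)) ≈
    A * sum p + B * sum (λ a → p a * x a) + sum (λ a → p a * y a) + C * sum (λ a → p a * z a)
  sum-linear {zero}  p x y z A B C = solve 3 (λ A B C → con (+ 0) :=
    A :* con (+ 0) :+ B :* con (+ 0) :+ con (+ 0) :+ C :* con (+ 0)) refl A B C
  sum-linear {suc n} p x y z A B C = trans
    (+-congˡ (sum-linear (p ∘ suc) (x ∘ suc) (y ∘ suc) (z ∘ suc) A B C))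
    (solve 11 (λ p x y z A B C P X Y Z →
      p :* (A :+ B :* x :+ y :+ C :* z) :+ (A :* P :+ B :* X :+ Y :+ C :* Z) :=
      A :* (p :+ P) :+ B :* (p :* x :+ X) :+ (p :* y :+ Y) :+ C :* (p :* z :+ Z)) refl
      (p zero) (x zero) (y zero) (z zero) A B C _ _ _ _)

  [_] : Bool → Carrier
  [ b ] = if b then 1# else 0#

  hits : ∀ {j n} → (Fin j → Fin n) → Fin n → Carrier
  hits u a = sum λ i → [ does (a Fin.≟ u i) ]

  sum-single : ∀ {n} (h : Fin n → Carrier) b → sum (λ a → h a * [ does (a Fin.≟ b) ]) ≈ h b
  sum-single {suc n} h zero = begin
    h zero * 1# + sum (λ a → h (suc a) * 0#)   ≈⟨ +-cong (*-identityʳ (h zero)) (sum-cong-≋ λ a → zeroʳ (h (suc a))) ⟩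
    h zero + sum {n} (λ _ → 0#)                ≈⟨ +-congˡ (sum-replicate-zero n) ⟩
    h zero + 0#                                ≈⟨ +-identityʳ (h zero) ⟩
    h zero                                     ∎
    where open ≈-Reasoning
  sum-single {suc n} h (suc b) = begin
    h zero * 0# + sum (λ a → h (suc a) * [ does (a Fin.≟ b) ])   ≈⟨ +-cong (zeroʳ (h zero)) (sum-single (h ∘ suc) b) ⟩
    0# + h (suc b)                                               ≈⟨ +-identityˡ (h (suc b)) ⟩
    h (suc b)                                                    ∎
    where open ≈-Reasoning

  -- Exchanging the sums leaves one nonzero term for each position of `u`. This turns an average
  -- over the next draw into a sum over the earlier draws.
  sum-hits : ∀ {j n} (h : Fin n → Carrier) (u : Fin j → Fin n) →
    sum (λ a → h a * hits u a) ≈ sum (h ∘ u)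
  sum-hits h u = begin
    sum (λ a → h a * hits u a)                           ≈⟨ sum-cong-≋ (λ a → *-distribˡ-sum (h a) λ i → [ does (a Fin.≟ u i) ]) ⟩
    sum (λ a → sum λ i → h a * [ does (a Fin.≟ u i) ])   ≈⟨ ∑-comm (λ a i → h a * [ does (a Fin.≟ u i) ]) ⟩
    sum (λ i → sum λ a → h a * [ does (a Fin.≟ u i) ])   ≈⟨ sum-cong-≋ (λ i → sum-single h (u i)) ⟩
    sum (h ∘ u)                                          ∎
    where open ≈-Reasoning

  count : ∀ j → (Fin j → Bool) → ℕ
  count zero    bs = 0
  count (suc j) bs = (if bs zero then 1 else 0) ℕ.+ count j (bs ∘ suc)

  fromℕ-count : ∀ j bs → fromℕ (count j bs) ≈ sum (λ i → [ bs i ])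
  fromℕ-count zero    bs = refl
  fromℕ-count (suc j) bs with bs zero
  ... | true  = +-congˡ (fromℕ-count j (bs ∘ suc))
  ... | false = trans (fromℕ-count j (bs ∘ suc)) (sym (+-identityˡ _))

  -- The natural number that the algorithm computes by its tests; `hits` is its image in the field,
  -- which is easier to sum.
  occurrences : ∀ {j n} → (Fin j → Fin n) → Fin n → ℕ
  occurrences {j} u a = count j λ i → does (a Fin.≟ u i)

  fresh⇒occurrences≡0 : ∀ {j n} (u : Fin j → Fin n) {a} → (∀ i → a ≢ u i) → occurrences u a ≡ 0
  fresh⇒occurrences≡0 {zero}  u     fresh = ≡.refl
  fresh⇒occurrences≡0 {suc j} u {a} fresh with a Fin.≟ u zero
  ... | yes a≡u₀ = contradiction a≡u₀ (fresh zero)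
  ... | no  _    = fresh⇒occurrences≡0 (u ∘ suc) (fresh ∘ suc)

  occurrences≡0⇒fresh : ∀ {j n} (u : Fin j → Fin n) {a} → occurrences u a ≡ 0 → ∀ i → a ≢ u i
  occurrences≡0⇒fresh u {a} eq zero    with a Fin.≟ u zero
  ... | no a≢u₀ = a≢u₀
  occurrences≡0⇒fresh u {a} eq (suc i) with a Fin.≟ u zero
  ... | no _    = occurrences≡0⇒fresh (u ∘ suc) eq i

  injective⇒occurrences≤1 : ∀ {j n} {u : Fin j → Fin n} → Injective _≡_ _≡_ u →
                            ∀ a → occurrences u a ℕ.≤ 1
  injective⇒occurrences≤1 {zero}          inj a = ℕ.z≤n
  injective⇒occurrences≤1 {suc j} {u = u} inj a with a Fin.≟ u zero
  ... | no  _    = injective⇒occurrences≤1 {u = u ∘ suc} (Fin.suc-injective ∘ inj) a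
  ... | yes a≡u₀ rewrite fresh⇒occurrences≡0 (u ∘ suc) {a} (λ i a≡uᵢ → Fin.0≢1+n (inj (≡.trans (≡.sym a≡u₀) a≡uᵢ)))
    = ℕ.s≤s ℕ.z≤n

-- Expectations over runs that are cut off.

module Expectation (ℝ : Reals) (A : Hybrid.Algorithm ℝ) (I : Hybrid.Instance ℝ)
                   (1≤n : 1 ≤ℕ Hybrid.Instance.size I)
                   (0<W : Reals._<_ ℝ (Reals.0# ℝ) (Hybrid.Instance.W I)) where
  open Hybrid ℝ
  open OrderedField ℝ
  open FiniteSums ℝ
  open Instance I public renaming (size to n)
  open Algorithm A
  open Run A I

  0<n : 0# < fromℕ n
  0<n = <-≤-trans (0<fromℕ-suc 0) (fromℕ-mono-≤ 1≤n)

  p q : Fin n → Carrier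
  p a = w a / W
  q a = 1# / fromℕ n

  p-nonNeg : ∀ a → 0# ≤ p a
  p-nonNeg a = *-nonNegative (w-nonNeg a) (⁻¹-nonNegative 0<W)

  q-nonNeg : ∀ a → 0# ≤ q a
  q-nonNeg a = *-nonNegative 0≤1 (⁻¹-nonNegative 0<n)

  sum-p : sum p ≈ 1#
  sum-p = trans (sym (*-distribʳ-sum (W ⁻¹) w)) (⁻¹-inverseʳ (<⇒≉ 0<W))

  sum-q : sum q ≈ 1#
  sum-q = trans (sum-const n (1# / fromℕ n)) (trans (*-comm (fromℕ n) _) (x/y*y≈x 0<n))

  half : Carrier
  half = 1# / fromℕ 2

  0≤half : 0# ≤ half
  0≤half = *-nonNegative 0≤1 (⁻¹-nonNegative (0<fromℕ-suc 1))

  half+half : half + half ≈ 1#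
  half+half = trans (solve 1 (λ h → h :+ h := h :* con (+ 2)) refl half) (x/y*y≈x (0<fromℕ-suc 1))

  -- Potentials give upper bounds only; passing to the complementary payoff turns one into the lower
  -- bound needed for a probability of success.
  expect-complement : ∀ {g h} → (∀ k m → g k m + h k m ≈ 1#) →
    ∀ t {k} (v : Vec (Fin n) k) s → expect g t v s + expect h t v s ≈ 1#
  expect-complement g+h zero    {k} v s = g+h k nothing
  expect-complement g+h (suc t) {k} v s with step s
  ... | return x       = g+h k (just x)
  ... | test i j c     = expect-complement g+h t v _
  ... | proportional c = trans (sym (∑-distrib-+ {n} _ _))
    (trans (sum-cong-≋ {n} λ a → trans (sym (distribˡ (p a) _ _)) (*-congˡ (expect-complement g+h t (a ∷ v) (c (w a)))))
      (average p 1# sum-p))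
  ... | uniform c = trans (sym (∑-distrib-+ {n} _ _))
    (trans (sum-cong-≋ {n} λ a → trans (sym (distribˡ (q a) _ _)) (*-congˡ (expect-complement g+h t (a ∷ v) (c (w a)))))
      (average q 1# sum-q))
  ... | coin c = trans
    (solve 5 (λ h a b c d → (h :* a :+ h :* b) :+ (h :* c :+ h :* d) := h :* (a :+ c) :+ h :* (b :+ d)) refl half _ _ _ _)
    (trans (+-cong (*-congˡ (expect-complement g+h t v (c true))) (*-congˡ (expect-complement g+h t v (c false))))
      (trans (+-cong (*-identityʳ half) (*-identityʳ half)) half+half))

  expect-mono : ∀ {g h} → (∀ k m → g k m ≤ h k m) →
    ∀ t {k} (v : Vec (Fin n) k) s → expect g t v s ≤ expect h t v s
  expect-mono g≤h zero    {k} v s = g≤h k nothing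
  expect-mono g≤h (suc t) {k} v s with step s
  ... | return x       = g≤h k (just x)
  ... | test i j c     = expect-mono g≤h t v _
  ... | proportional c = sum-mono-≤ {n} λ a → *-monoˡ-≤ (p-nonNeg a) (expect-mono g≤h t (a ∷ v) _)
  ... | uniform c      = sum-mono-≤ {n} λ a → *-monoˡ-≤ (q-nonNeg a) (expect-mono g≤h t (a ∷ v) _)
  ... | coin c         = +-mono-≤ (*-monoˡ-≤ 0≤half (expect-mono g≤h t v _)) (*-monoˡ-≤ 0≤half (expect-mono g≤h t v _))

  expect-const : ∀ x t {k} (v : Vec (Fin n) k) s → expect (λ _ _ → x) t v s ≈ x
  expect-const x zero    v s = refl
  expect-const x (suc t) v s with step s
  ... | return _       = refl
  ... | test i j c     = expect-const x t v _
  ... | proportional c = trans (sum-cong-≋ {n} λ a → *-congˡ (expect-const x t (a ∷ v) _)) (average p x sum-p)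
  ... | uniform c      = trans (sum-cong-≋ {n} λ a → *-congˡ (expect-const x t (a ∷ v) _)) (average q x sum-q)
  ... | coin c         = trans (+-cong (*-congˡ (expect-const x t v _)) (*-congˡ (expect-const x t v _)))
    (trans (sym (distribʳ x half half)) (trans (*-congʳ half+half) (*-identityˡ x)))

  expect-≤-const : ∀ {g b} → (∀ k m → g k m ≤ b) → ∀ t {k} (v : Vec (Fin n) k) s → expect g t v s ≤ b
  expect-≤-const {b = b} g≤b t v s = ≤-respʳ (expect-const b t v s) (expect-mono g≤b t v s)

  module _ {g : ℕ → Maybe Carrier → Carrier}
           (g-return : ∀ k x → g k nothing ≤ g k (just x))
           (g-sample : ∀ k → g k nothing ≤ g (suc k) nothing) where

    -- Only runs still going at the cut-off change, and by the two hypotheses neither returning nor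
    -- drawing lowers their payoff.
    expect-suc : ∀ t {k} (v : Vec (Fin n) k) s → expect g t v s ≤ expect g (suc t) v s
    expect-suc zero {k} v s with step s
    ... | return x       = g-return k x
    ... | test i j c     = ≤-refl
    ... | proportional c = ≤-respʳ (sym (average p _ sum-p)) (g-sample k)
    ... | uniform c      = ≤-respʳ (sym (average q _ sum-q)) (g-sample k)
    ... | coin c         = ≤-reflexive (sym (trans (sym (distribʳ _ half half)) (trans (*-congʳ half+half) (*-identityˡ _))))
    expect-suc (suc t) {k} v s with step s
    ... | return x       = ≤-refl
    ... | test i j c     = expect-suc t v _
    ... | proportional c = sum-mono-≤ {n} λ a → *-monoˡ-≤ (p-nonNeg a) (expect-suc t (a ∷ v) _)
    ... | uniform c      = sum-mono-≤ {n} λ a → *-monoˡ-≤ (q-nonNeg a) (expect-suc t (a ∷ v) _)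
    ... | coin c         = +-mono-≤ (*-monoˡ-≤ 0≤half (expect-suc t v _)) (*-monoˡ-≤ 0≤half (expect-suc t v _))

    expect-increasing : ∀ {t t′} → t ≤ℕ t′ → ∀ {k} (v : Vec (Fin n) k) s → expect g t v s ≤ expect g t′ v s
    expect-increasing t≤t′ v s = go (ℕ.≤⇒≤′ t≤t′)
      where
      go : ∀ {t t′} → t ℕ.≤′ t′ → expect g t v s ≤ expect g t′ v s
      go ℕ.≤′-refl               = ≤-refl
      go (ℕ.≤′-step {t′} t≤′t′) = ≤-trans (go t≤′t′) (expect-suc t′ v s)

-- Properties of all sufficiently late cut-offs.

Eventually : (ℕ → Set) → Set
Eventually P = ∃[ T ] (∀ t → T ≤ℕ t → P t)

-- The maximum of finitely many thresholds serves all outcomes of a draw at once.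
eventually-∀ : ∀ {n} {P : Fin n → ℕ → Set} → (∀ a → Eventually (P a)) → Eventually (λ t → ∀ a → P a t)
eventually-∀ {zero}  ev = 0 , λ _ _ ()
eventually-∀ {suc n} ev =
  let T₀ , ev₀ = ev zero
      T₁ , ev₁ = eventually-∀ (ev ∘ suc)
  in T₀ ℕ.⊔ T₁ , λ t T≤t → λ { zero    → ev₀ t (ℕ.≤-trans (ℕ.m≤m⊔n T₀ T₁) T≤t)
                           ; (suc a) → ev₁ t (ℕ.≤-trans (ℕ.m≤n⊔m T₀ T₁) T≤t) a }

eventually-suc : ∀ {P : ℕ → Set} → Eventually (P ∘ suc) → Eventually P
eventually-suc (T , ev) = suc T , λ { (suc t) (ℕ.s≤s T≤t) → ev t T≤t }

-- The binomial coefficient C(j,2): a new sample forms one pair with each of the `j` earlier ones.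
pairs : ℕ → ℕ
pairs zero    = 0
pairs (suc j) = j ℕ.+ pairs j

-- The algorithm.

module CollisionEstimator (ℝ : Reals) where
  open Hybrid ℝ
  open OrderedField ℝ

  -- The uniform phase has no length bound known to the algorithm, so it is a marker that `step`
  -- unfolds. What follows it is a well-founded tree of actions, stored in the state.
  data State (k : ℕ) : Set where
    collide : State k
    perform : Action State k → State k

  matches : ∀ j {k} → (Fin j → Fin k) → (ℕ → State (suc k)) → State (suc k)
  matches zero    f κ = κ 0
  matches (suc j) f κ = perform (test zero (suc (f zero)) λ b →
    matches j (f ∘ suc) λ c → κ ((if b then 1 else 0) ℕ.+ c))

  -- There are `l` draws to come and `j` done. Recent items come first, so `_↑ˡ k₀` selects the
  -- proportional samples and leaves the `k₀` older uniform ones out of the comparison.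
  estimate : (l j : ℕ) {k₀ : ℕ} → Carrier → State (j ℕ.+ k₀)
  estimate zero    j      S = perform (return (fromℕ (pairs j) / S))
  estimate (suc l) j {k₀} S = perform (proportional λ x →
    matches j (_↑ˡ k₀) λ c → estimate l (suc j) {k₀} (S + fromℕ c * x ⁻¹))

  -- The factor 28 makes ε m at least 14 √n as soon as 2K ≥ √n, enough for a failure probability of
  -- 1/12.
  repetitions : Carrier → ℕ → ℕ
  repetitions ε K = 28 ℕ.* (proj₁ (ceiling (ε ⁻¹)) ℕ.* K)

  -- The sample that completes the repetition is included in K, hence `suc k`.
  afterMatches : Carrier → ∀ {k} → ℕ → State (suc k)
  afterMatches ε     zero    = collide
  afterMatches ε {k} (suc _) = estimate (repetitions ε (suc k)) 0 {suc k} 0#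

  algorithm : Carrier → Algorithm
  algorithm ε = record { State = State ; start = collide ; step = step }
    where
    step : ∀ {k} → State k → Action State k
    step (perform action) = action
    step {k} collide      = uniform λ _ → matches k id (afterMatches ε)

-- The potential method for the two phases.

module Analysis (ℝ : Reals) (ε : Reals.Carrier ℝ) (I : Hybrid.Instance ℝ)
                (1≤n : 1 ≤ℕ Hybrid.Instance.size I)
                (0<W : Reals._<_ ℝ (Reals.0# ℝ) (Hybrid.Instance.W I)) where
  open Hybrid ℝ
  open OrderedField ℝ
  open FiniteSums ℝ
  open CollisionEstimator ℝ
  open Run (algorithm ε) I
  open Expectation ℝ (algorithm ε) I 1≤n 0<W

  EventuallyAtMost : (ℕ → Maybe Carrier → Carrier) → ∀ {k} → Vec (Fin n) k → State k → Carrier → Set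
  EventuallyAtMost g v s b = Eventually λ t → expect g t v s ≤ b

  eventually-≤ : ∀ {g k} {v : Vec (Fin n) k} {s b c} → b ≤ c → EventuallyAtMost g v s b → EventuallyAtMost g v s c
  eventually-≤ b≤c (T , ev) = T , λ t T≤t → ≤-trans (ev t T≤t) b≤c

  -- Tests draw nothing and their answers are determined by the items; `count` recurses exactly as
  -- `matches` does, so the continuation receives `occurrences` by computation.
  matches-eventually : ∀ {g b k a} {v : Vec (Fin n) k} j f κ →
    EventuallyAtMost g (a ∷ v) (κ (occurrences {j} (lookup v ∘ f) a)) b →
    EventuallyAtMost g (a ∷ v) (matches j f κ) b
  matches-eventually zero    f κ ev = ev
  matches-eventually (suc j) f κ ev = eventually-suc (matches-eventually j (f ∘ suc) _ ev)

  drawn : ∀ j {k₀} → Vec (Fin n) (j ℕ.+ k₀) → Fin j → Fin n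
  drawn j {k₀} v i = lookup v (i ↑ˡ k₀)

  -- Holds with probability 1 for proportional samples, and makes the inverse weights in the
  -- statistic meaningful.
  Weighted : ∀ j {k₀} → Vec (Fin n) (j ℕ.+ k₀) → Set
  Weighted j v = ∀ i → 0# < w (drawn j v i)

  -- Induction on `l`: the first hypothesis lets `F` dominate the payoff at the return, and the
  -- second makes `F` a supermartingale over one draw. The equation `l + j ≡ m` ties the reachable
  -- states to a run of `m` draws.
  estimate-eventually : ∀ {g k₀} m (F : (l j : ℕ) → Vec (Fin n) (j ℕ.+ k₀) → Carrier → Carrier) →
    (∀ v S → g (m ℕ.+ k₀) (just (fromℕ (pairs m) / S)) ≤ F 0 m v S) →
    (∀ l j v S → Weighted j v →
      sum (λ a → p a * F l (suc j) (a ∷ v) (S + fromℕ (occurrences (drawn j v) a) * w a ⁻¹)) ≤ F (suc l) j v S) →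
    ∀ l j v S → l ℕ.+ j ≡ m → Weighted j v → EventuallyAtMost g v (estimate l j {k₀} S) (F l j v S)
  estimate-eventually m F base step zero    j v S ≡.refl wd = eventually-suc (0 , λ _ _ → base v S)
  estimate-eventually {g} {k₀} m F base step (suc l) j v S eq wd = eventually-suc
    (let T , ev = eventually-∀ draw in T , λ t T≤t → ≤-trans (sum-mono-≤ (ev t T≤t)) (step l j v S wd))
    where
    next : Fin n → Carrier
    next a = S + fromℕ (occurrences (drawn j v) a) * w a ⁻¹
    draw : ∀ a → Eventually λ t →
      p a * expect g t (a ∷ v) (matches j (_↑ˡ k₀) λ c → estimate l (suc j) {k₀} (S + fromℕ c * w a ⁻¹)) ≤
      p a * F l (suc j) (a ∷ v) (next a)
    draw a with w a ≤? 0#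
    -- The value of w a ⁻¹ is unspecified here, but a is never drawn.
    ... | yes wa≤0 = 0 , λ _ _ → ≤-reflexive (trans (vanish _) (sym (vanish _)))
      where
      vanish : ∀ x → p a * x ≈ 0#
      vanish x = trans (*-congʳ (trans (*-congʳ (antisym wa≤0 (w-nonNeg a))) (zeroˡ (W ⁻¹)))) (zeroˡ x)
    ... | no  wa≰0 =
      let T , ev = matches-eventually j (_↑ˡ k₀) _
            (estimate-eventually m F base step l (suc j) (a ∷ v) (next a) (≡.trans (ℕ.+-suc l j) eq) wd′)
      in T , λ t T≤t → *-monoˡ-≤ (p-nonNeg a) (ev t T≤t)
      where
      wd′ : Weighted (suc j) (a ∷ v)
      wd′ zero    = ≰⇒> wa≰0
      wd′ (suc i) = wd i

  ∷-injective : ∀ {d} {v : Vec (Fin n) d} {a} → Injective _≡_ _≡_ (lookup v) → (∀ i → a ≢ lookup v i) →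
                Injective _≡_ _≡_ (lookup (a ∷ v))
  ∷-injective inj fresh {zero}  {zero}  eq = ≡.refl
  ∷-injective inj fresh {zero}  {suc j} eq = contradiction eq (fresh j)
  ∷-injective inj fresh {suc i} {zero}  eq = contradiction (≡.sym eq) (fresh i)
  ∷-injective inj fresh {suc i} {suc j} eq = ≡.cong suc (inj eq)

  -- With `d` distinct items seen, a uniform draw repeats one with probability d / n, so the
  -- recurrence is the supermartingale condition times n, with `f` bounding the estimation phase.
  -- The induction on `l` is founded because n + 1 distinct items contradict the pigeonhole
  -- principle.
  collide-eventually : ∀ {g} (f Ψ : ℕ → Carrier) →
    (∀ k (v : Vec (Fin n) (suc k)) → EventuallyAtMost g v (estimate (repetitions ε (suc k)) 0 {suc k} 0#) (f (suc k))) →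
    (∀ d → fromℕ d * f (suc d) + (fromℕ n - fromℕ d) * Ψ (suc d) ≤ fromℕ n * Ψ d) →
    ∀ l d v → l ℕ.+ d ≡ suc n → Injective _≡_ _≡_ (lookup v) → EventuallyAtMost g v (collide {d}) (Ψ d)
  collide-eventually f Ψ stop rec zero    d v ≡.refl inj = contradiction (Fin.injective⇒≤ inj) ℕ.1+n≰n
  collide-eventually {g} f Ψ stop rec (suc l) d v eq inj = eventually-suc
    (let T , ev = eventually-∀ draw in T , λ t T≤t → ≤-trans (sum-mono-≤ λ a → *-monoˡ-≤ (q-nonNeg a) (ev t T≤t a)) average-mix)
    where
    y = Ψ (suc d)
    z = f (suc d) - y
    -- This is `y` at a fresh item and `f (suc d)` at a repeated one, as distinct items are hit at
    -- most once. Being affine in `hits`, it can be summed by `sum-hits`.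
    mix : Fin n → Carrier
    mix a = y + z * hits (lookup v) a

    draw : ∀ a → EventuallyAtMost g (a ∷ v) (matches d id (afterMatches ε)) (mix a)
    draw a = matches-eventually d id _ (cases (occurrences (lookup v) a) ≡.refl)
      where
      hits≈ : ∀ c → occurrences (lookup v) a ≡ c → hits (lookup v) a ≈ fromℕ c
      hits≈ c ≡.refl = sym (fromℕ-count d _)
      cases : ∀ c → occurrences (lookup v) a ≡ c → EventuallyAtMost g (a ∷ v) (afterMatches ε c) (mix a)
      cases zero occ = eventually-≤
        (≤-reflexive (sym (trans (+-congˡ (trans (*-congˡ (hits≈ 0 occ)) (zeroʳ z))) (+-identityʳ y))))
        (collide-eventually f Ψ stop rec l (suc d) (a ∷ v) (≡.trans (ℕ.+-suc l d) eq)
          (∷-injective inj (occurrences≡0⇒fresh (lookup v) occ)))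
      cases (suc zero) occ = eventually-≤
        (≤-reflexive (sym (trans (+-congˡ (*-congˡ (hits≈ 1 occ)))
          (solve 2 (λ x y → y :+ (x :- y) :* (con (+ 1) :+ con (+ 0)) := x) refl (f (suc d)) y))))
        (stop d (a ∷ v))
      cases (suc (suc c)) occ with ℕ.s≤s () ← ≡.subst (_≤ℕ 1) occ (injective⇒occurrences≤1 inj a)

    average-mix : sum (λ a → q a * mix a) ≤ Ψ d
    average-mix = *-cancelˡ-≤ 0<n (begin
      fromℕ n * sum (λ a → q a * mix a)         ≈⟨ *-distribˡ-sum (fromℕ n) (λ a → q a * mix a) ⟩
      sum (λ a → fromℕ n * (q a * mix a))       ≈⟨ sum-cong-≋ (λ a → cancel (mix a)) ⟩
      sum mix                                   ≈⟨ ∑-distrib-+ (λ _ → y) (λ a → z * hits (lookup v) a) ⟩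
      sum {n} (λ _ → y) + sum (λ a → z * hits (lookup v) a)
        ≈⟨ +-cong (sum-const n y) (trans (sum-hits (λ _ → z) (lookup v)) (sum-const d z)) ⟩
      fromℕ n * y + fromℕ d * z                 ≈⟨ solve 4 (λ n d x y →
        n :* y :+ d :* (x :- y) := d :* x :+ (n :- d) :* y) refl (fromℕ n) (fromℕ d) (f (suc d)) y ⟩
      fromℕ d * f (suc d) + (fromℕ n - fromℕ d) * y   ≤⟨ rec d ⟩
      fromℕ n * Ψ d                             ∎)
      where
      open ≤-Reasoning
      cancel : ∀ x → fromℕ n * (1# / fromℕ n * x) ≈ x
      cancel x = trans (solve 3 (λ n q x → n :* (q :* x) := (q :* n) :* x) refl (fromℕ n) (1# / fromℕ n) x)
                   (trans (*-congʳ (x/y*y≈x 0<n)) (*-identityˡ x))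

-- The second moment of the collision statistic.

module SecondMoment (ℝ : Reals) (ε : Reals.Carrier ℝ) (I : Hybrid.Instance ℝ)
                    (1≤n : 1 ≤ℕ Hybrid.Instance.size I)
                    (0<W : Reals._<_ ℝ (Reals.0# ℝ) (Hybrid.Instance.W I)) where
  open Hybrid ℝ
  open OrderedField ℝ
  open FiniteSums ℝ
  open CollisionEstimator ℝ
  open Analysis ℝ ε I 1≤n 0<W
  open Expectation ℝ (algorithm ε) I 1≤n 0<W

  i : Carrier
  i = W ⁻¹

  W*i : W * i ≈ 1#
  W*i = ⁻¹-inverseʳ (<⇒≉ 0<W)

  0≤i : 0# ≤ i
  0≤i = ⁻¹-nonNegative 0<W

  w⁻¹ : Fin n → Carrier
  w⁻¹ a = w a ⁻¹

  p*w⁻¹ : ∀ {a} → 0# < w a → p a * w a ⁻¹ ≈ i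
  p*w⁻¹ {a} 0<wa = trans (solve 3 (λ w i v → (w :* i) :* v := i :* (w :* v)) refl (w a) i (w a ⁻¹))
    (trans (*-congˡ (⁻¹-inverseʳ (<⇒≉ 0<wa))) (*-identityʳ i))

  -- A weightless item has `p a` zero, so the left side vanishes whatever its unspecified inverse
  -- is; only the inequality covers all items.
  p*w⁻¹≤ : ∀ a → p a * w a ⁻¹ ≤ i
  p*w⁻¹≤ a with w a ≤? 0#
  ... | no  wa≰0 = ≤-reflexive (p*w⁻¹ (≰⇒> wa≰0))
  ... | yes wa≤0 = ≤-respˡ (sym (trans (*-congʳ (trans (*-congʳ (antisym wa≤0 (w-nonNeg a))) (zeroˡ i))) (zeroˡ _))) 0≤i

  module _ {j} (u : Fin j → Fin n) where

    increment : Fin n → Carrier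
    increment a = w a ⁻¹ * hits u a

    -- With c(a) the multiplicity of a in `u`, this is the sum of c(a)² / w(a) over the items a that
    -- occur in `u`. By `mean-increment²` it is W times the second moment of the next increment.
    energy : Carrier
    energy = sum (increment ∘ u)

    module _ (wd : ∀ k → 0# < w (u k)) where

      -- Each earlier sample b is hit with probability w(b) / W and then contributes 1 / w(b), that
      -- is 1 / W on average.
      mean-increment : sum (λ a → p a * increment a) ≈ fromℕ j * i
      mean-increment = begin
        sum (λ a → p a * increment a)              ≈⟨ sum-cong-≋ (λ a → sym (*-assoc (p a) (w a ⁻¹) (hits u a))) ⟩
        sum (λ a → (p a * w a ⁻¹) * hits u a)      ≈⟨ sum-hits (λ a → p a * w a ⁻¹) u ⟩
        sum (λ k → p (u k) * w (u k) ⁻¹)           ≈⟨ sum-cong-≋ (λ k → p*w⁻¹ (wd k)) ⟩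
        sum {j} (λ _ → i)                          ≈⟨ sum-const j i ⟩
        fromℕ j * i                                ∎
        where open ≈-Reasoning

      -- One of the two factors `hits u a` is spent on `sum-hits`; the other remains inside
      -- `energy`.
      mean-increment² : sum (λ a → p a * (increment a * increment a)) ≈ i * energy
      mean-increment² = begin
        sum (λ a → p a * (increment a * increment a))
          ≈⟨ sum-cong-≋ (λ a → solve 3 (λ p v h →
              p :* ((v :* h) :* (v :* h)) := ((p :* v) :* (v :* h)) :* h) refl (p a) (w a ⁻¹) (hits u a)) ⟩
        sum (λ a → ((p a * w a ⁻¹) * increment a) * hits u a)
          ≈⟨ sum-hits (λ a → (p a * w a ⁻¹) * increment a) u ⟩
        sum (λ k → (p (u k) * w (u k) ⁻¹) * increment (u k))   ≈⟨ sum-cong-≋ (λ k → *-congʳ (p*w⁻¹ (wd k))) ⟩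
        sum (λ k → i * increment (u k))                        ≈⟨ *-distribˡ-sum i (increment ∘ u) ⟨
        i * energy                                             ∎
        where open ≈-Reasoning

  -- Raising one multiplicity from c to c + 1 adds (2c + 1) / w. The double sum is symmetric because
  -- `[ b = a ] / w b` is.
  energy-∷ : ∀ {j} (u : Fin (suc j) → Fin n) →
    energy u ≈ energy (u ∘ suc) + fromℕ 2 * increment (u ∘ suc) (u zero) + w (u zero) ⁻¹
  energy-∷ {j} u = begin
    v a * (δ a a + h a) + sum (λ k → v (u′ k) * (δ (u′ k) a + h (u′ k)))
      ≈⟨ +-cong (*-congˡ (+-congʳ diagonal)) (sum-cong-≋ λ k → distribˡ (v (u′ k)) (δ (u′ k) a) (h (u′ k))) ⟩
    v a * (1# + h a) + sum (λ k → v (u′ k) * δ (u′ k) a + v (u′ k) * h (u′ k))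
      ≈⟨ +-congˡ (∑-distrib-+ (λ k → v (u′ k) * δ (u′ k) a) (λ k → v (u′ k) * h (u′ k))) ⟩
    v a * (1# + h a) + (sum (λ k → v (u′ k) * δ (u′ k) a) + energy u′)
      ≈⟨ +-congˡ (+-congʳ (trans (sum-cong-≋ λ k → symmetric (u′ k)) (sym (*-distribˡ-sum (v a) (λ k → δ a (u′ k)))))) ⟩
    v a * (1# + h a) + (v a * h a + energy u′)
      ≈⟨ solve 3 (λ v h e → v :* (con (+ 1) :+ h) :+ (v :* h :+ e) := e :+ con (+ 2) :* (v :* h) :+ v) refl (v a) (h a) (energy u′) ⟩
    energy u′ + fromℕ 2 * (v a * h a) + v a     ∎
    where
    open ≈-Reasoning
    a = u zero
    u′ = u ∘ suc
    h = hits u′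
    v = w⁻¹
    δ : Fin n → Fin n → Carrier
    δ a b = [ does (a Fin.≟ b) ]
    diagonal : δ a a ≈ 1#
    diagonal with a Fin.≟ a
    ... | yes _   = refl
    ... | no  a≢a = contradiction ≡.refl a≢a
    symmetric : ∀ b → v b * δ b a ≈ v a * δ a b
    symmetric b with b Fin.≟ a | a Fin.≟ b
    ... | yes ≡.refl | yes _   = refl
    ... | yes ≡.refl | no  a≢a = contradiction ≡.refl a≢a
    ... | no  b≢a    | yes a≡b = contradiction (≡.sym a≡b) b≢a
    ... | no  _      | no  _   = trans (zeroʳ (v b)) (sym (zeroʳ (v a)))

  module _ {k₀ : ℕ} where

    -- An upper bound for the conditional expectation of (S - pairs m / W)² at
    -- the end, when l of the m samples are still to be drawn.
    potential : (l j : ℕ) → Vec (Fin n) (j ℕ.+ k₀) → Carrier → Carrier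
    potential l j v S =
      (S - fromℕ (pairs j) * i) * (S - fromℕ (pairs j) * i)
      + fromℕ l * ((energy (drawn j v) - fromℕ j * fromℕ j * i) * i)
      + fromℕ (pairs l) * (fromℕ n * i * i)

    -- The next increment has conditional variance (E - j² / W) / W, where E is the energy. By
    -- `energy-∷`, E - j² / W grows on average by at most (n - 1) / W per draw; the potential
    -- charges n / W, which leaves the slack `l * (i * i)`.
    potential-step : ∀ l j v S → Weighted j v →
      sum (λ a → p a * potential l (suc j) (a ∷ v) (S + fromℕ (occurrences (drawn j v) a) * w a ⁻¹))
      ≤ potential (suc l) j v S
    potential-step l j v S wd = begin
      sum (λ a → p a * potential l (suc j) (a ∷ v) (S + fromℕ (occurrences u a) * w a ⁻¹))
        ≈⟨ sum-cong-≋ (λ a → *-congˡ (expand a)) ⟩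
      sum (λ a → p a * (A + B * x a + x a * x a + C * w⁻¹ a))
        ≈⟨ sum-linear p x (λ a → x a * x a) w⁻¹ A B C ⟩
      A * sum p + B * sum (λ a → p a * x a) + sum (λ a → p a * (x a * x a)) + C * sum (λ a → p a * w⁻¹ a)
        ≤⟨ +-mono-≤ (≤-reflexive (+-cong (+-cong (*-congˡ sum-p) (*-congˡ (mean-increment u wd))) (mean-increment² u wd)))
             (*-monoˡ-≤ (*-nonNegative (0≤fromℕ l) 0≤i) (≤-respʳ (sum-const n i) (sum-mono-≤ p*w⁻¹≤))) ⟩
      A * 1# + B * (J * i) + i * E + C * (fromℕ n * i)
        ≤⟨ ≤-by (*-nonNegative (0≤fromℕ l) (*-nonNegative 0≤i 0≤i)) (trans (+-congˡ (*-congʳ (fromℕ-+ l (pairs l))))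
             (solve 8 (λ S P i L E J N R →
               (S :- P :* i) :* (S :- P :* i) :+ (con (+ 1) :+ L) :* ((E :- J :* J :* i) :* i) :+ (L :+ R) :* (N :* i :* i) :=
               ((S :- (J :+ P) :* i) :* (S :- (J :+ P) :* i)
                  :+ L :* ((E :- (con (+ 1) :+ J) :* (con (+ 1) :+ J) :* i) :* i) :+ R :* (N :* i :* i)) :* con (+ 1)
               :+ (con (+ 2) :* (S :- (J :+ P) :* i) :+ con (+ 2) :* (L :* i)) :* (J :* i)
               :+ i :* E :+ (L :* i) :* (N :* i)
               :+ L :* (i :* i)) refl S (fromℕ (pairs j)) i (fromℕ l) E J (fromℕ n) (fromℕ (pairs l)))) ⟩
      potential (suc l) j v S   ∎
      where
      open ≤-Reasoning
      u = drawn j v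
      x = increment u
      E = energy u
      J = fromℕ j
      Y = S - (J + fromℕ (pairs j)) * i
      A = Y * Y + fromℕ l * ((E - fromℕ (suc j) * fromℕ (suc j) * i) * i) + fromℕ (pairs l) * (fromℕ n * i * i)
      B = fromℕ 2 * Y + fromℕ 2 * (fromℕ l * i)
      C = fromℕ l * i

      expand : ∀ a → potential l (suc j) (a ∷ v) (S + fromℕ (occurrences u a) * w a ⁻¹) ≈
               A + B * x a + x a * x a + C * w⁻¹ a
      expand a = trans
        (+-congʳ (+-cong (*-cong deviation deviation) (*-congˡ (*-congʳ (+-congʳ (energy-∷ (drawn (suc j) (a ∷ v))))))))
        (solve 8 (λ Y x L E e v i R →
          (Y :+ x) :* (Y :+ x) :+ L :* ((E :+ con (+ 2) :* x :+ v :- e) :* i) :+ R :=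
          (Y :* Y :+ L :* ((E :- e) :* i) :+ R) :+ (con (+ 2) :* Y :+ con (+ 2) :* (L :* i)) :* x :+ x :* x :+ (L :* i) :* v) refl
          Y (x a) (fromℕ l) E (fromℕ (suc j) * fromℕ (suc j) * i) (w a ⁻¹) i (fromℕ (pairs l) * (fromℕ n * i * i)))
        where
        deviation : (S + fromℕ (occurrences u a) * w a ⁻¹) - fromℕ (pairs (suc j)) * i ≈ Y + x a
        deviation = trans (+-cong (+-congˡ (*-congʳ (fromℕ-count j _))) (-‿cong (*-congʳ (fromℕ-+ j (pairs j)))))
          (solve 5 (λ S h v P i → S :+ h :* v :- P :* i := S :- P :* i :+ v :* h) refl
            S (hits u a) (w a ⁻¹) (J + fromℕ (pairs j)) i)

-- Quantities in terms of √n and 1/ε.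

module Bounds (ℝ : Reals) (ε : Reals.Carrier ℝ) (0<ε : Reals._<_ ℝ (Reals.0# ℝ) ε)
              (ε<1 : Reals._<_ ℝ ε (Reals.1# ℝ)) (I : Hybrid.Instance ℝ)
              (1≤n : 1 ≤ℕ Hybrid.Instance.size I)
              (0<W : Reals._<_ ℝ (Reals.0# ℝ) (Hybrid.Instance.W I)) where
  open Hybrid ℝ
  open OrderedField ℝ
  open FiniteSums ℝ
  open SquareRoot ℝ
  open CollisionEstimator ℝ
  open Run (algorithm ε) I
  open Expectation ℝ (algorithm ε) I 1≤n 0<W
  open Analysis ℝ ε I 1≤n 0<W
  open SecondMoment ℝ ε I 1≤n 0<W

  N : Carrier
  N = fromℕ n

  root : ∃[ r ] IsSqrt N r × 1# ≤ r
  root = sqrt N (≤-respˡ (+-identityʳ 1#) (fromℕ-mono-≤ 1≤n))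

  r : Carrier
  r = proj₁ root

  rr≈N : r * r ≈ N
  rr≈N = proj₂ (proj₁ (proj₂ root))

  1≤r : 1# ≤ r
  1≤r = proj₂ (proj₂ root)

  0≤r : 0# ≤ r
  0≤r = ≤-trans 0≤1 1≤r

  ε≤1 : ε ≤ 1#
  ε≤1 = proj₁ ε<1

  1≤ε⁻¹ : 1# ≤ ε ⁻¹
  1≤ε⁻¹ = *-cancelˡ-≤ 0<ε (≤-respˡ (sym (*-identityʳ ε)) (≤-respʳ (sym (⁻¹-inverseʳ (<⇒≉ 0<ε))) ε≤1))

  ⌈ε⁻¹⌉ : ℕ
  ⌈ε⁻¹⌉ = proj₁ (ceiling (ε ⁻¹))

  1≤ε*⌈ε⁻¹⌉ : 1# ≤ ε * fromℕ ⌈ε⁻¹⌉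
  1≤ε*⌈ε⁻¹⌉ = ≤-respˡ (⁻¹-inverseʳ (<⇒≉ 0<ε)) (*-monoˡ-≤ (proj₁ 0<ε) (proj₁ (proj₂ (ceiling (ε ⁻¹)))))

  ⌈ε⁻¹⌉≤2ε⁻¹ : fromℕ ⌈ε⁻¹⌉ ≤ fromℕ 2 * ε ⁻¹
  ⌈ε⁻¹⌉≤2ε⁻¹ with proj₂ (proj₂ (ceiling (ε ⁻¹)))
  ... | inj₁ c≡0 = ≤-respˡ (reflexive (≡.cong fromℕ (≡.sym c≡0))) (*-nonNegative (0≤fromℕ 2) (≤-trans 0≤1 1≤ε⁻¹))
  ... | inj₂ c≤  = ≤-trans c≤ (≤-by (x≤y⇒0≤y-x 1≤ε⁻¹)
    (solve 1 (λ e → con (+ 2) :* e := (e :+ con (+ 1)) :+ (e :- con (+ 1))) refl (ε ⁻¹)))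

  -- The estimation phase: return, sample count and failure probability.

  module _ {k₀ : ℕ} (v : Vec (Fin n) k₀) (m : ℕ) where

    estimate-returns : ∀ {g b} → (∀ k x → g k (just x) ≤ b) → EventuallyAtMost g v (estimate m 0 {k₀} 0#) b
    estimate-returns {b = b} g≤b = estimate-eventually m (λ _ _ _ _ → b) (λ _ _ → g≤b _ _)
      (λ l j _ S _ → ≤-reflexive (average p b sum-p)) m 0 v 0# (ℕ.+-identityʳ m) λ ()

    estimate-samples : EventuallyAtMost (λ k _ → fromℕ k) v (estimate m 0 {k₀} 0#) (fromℕ (m ℕ.+ k₀))
    estimate-samples = estimate-eventually m (λ l j _ _ → fromℕ (l ℕ.+ (j ℕ.+ k₀))) (λ _ _ → ≤-refl)
      (λ l j _ S _ → ≤-reflexive (trans (average p _ sum-p) (reflexive (≡.cong fromℕ (ℕ.+-suc l (j ℕ.+ k₀))))))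
      m 0 v 0# (ℕ.+-identityʳ m) λ ()

  -- A run that is cut off counts as a failure, which makes this exactly complementary to
  -- `indicator`.
  miss : {P : Pred Carrier 0ℓ} → Decidable P → ℕ → Maybe Carrier → Carrier
  miss P? k nothing  = 1#
  miss P? k (just x) = if does (P? x) then 0# else 1#

  indicator+miss : {P : Pred Carrier 0ℓ} (P? : Decidable P) → ∀ k m → indicator P? k m + miss P? k m ≈ 1#
  indicator+miss P? k nothing  = +-identityˡ 1#
  indicator+miss P? k (just x) with does (P? x)
  ... | true  = +-identityʳ 1#
  ... | false = +-identityˡ 1#

  miss≤1 : {P : Pred Carrier 0ℓ} (P? : Decidable P) → ∀ k m → miss P? k m ≤ 1#
  miss≤1 P? k nothing  = ≤-refl
  miss≤1 P? k (just x) with does (P? x)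
  ... | true  = 0≤1
  ... | false = ≤-refl

  indicator≤1 : {P : Pred Carrier 0ℓ} (P? : Decidable P) → ∀ k m → indicator P? k m ≤ 1#
  indicator≤1 P? k nothing  = 0≤1
  indicator≤1 P? k (just x) with does (P? x)
  ... | true  = ≤-refl
  ... | false = 0≤1

  miss-returned : {P : Pred Carrier 0ℓ} (P? : Decidable P) → ∀ {b} k x →
    0# ≤ b → (¬ P x → 1# ≤ b) → miss P? k (just x) ≤ b
  miss-returned P? k x 0≤b 1≤b with P? x
  ... | yes _  = 0≤b
  ... | no  ¬p = 1≤b ¬p

  -- A relative error of ε/2 in S suffices for its reciprocal, since (1 - ε)(1 + ε/2) ≤ 1 ≤ (1 +
  -- ε)(1 - ε/2) when ε ≤ 1. The lower bound also forces S to be positive.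
  accurate-by : ∀ {P S} → 0# < P → fromℕ 2 * (W * S - P) ≤ ε * P → fromℕ 2 * (P - W * S) ≤ ε * P →
    Accurate ε I (P / S)
  accurate-by {P} {S} 0<P upper lower = ≤-/ 0<S (*-cancelˡ-≤ (0<fromℕ-suc 1) below) , /-≤ 0<S (*-cancelˡ-≤ (0<fromℕ-suc 1) above)
    where
    0≤P = proj₁ 0<P
    0≤ε = proj₁ 0<ε
    P≤2WS : P ≤ fromℕ 2 * (W * S)
    P≤2WS = ≤-by (+-nonNegative (x≤y⇒0≤y-x lower) (*-nonNegative (x≤y⇒0≤y-x ε≤1) 0≤P))
      (solve 3 (λ e P Z → con (+ 2) :* Z := P :+ (e :* P :- con (+ 2) :* (P :- Z) :+ (con (+ 1) :- e) :* P)) refl ε P (W * S))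
    0<S : 0# < S
    0<S = ≰⇒> λ S≤0 → <⇒≱ 0<P (≤-trans P≤2WS (≤-respʳ
      (trans (*-congˡ (zeroʳ W)) (zeroʳ (fromℕ 2))) (*-monoˡ-≤ (0≤fromℕ 2) (*-monoˡ-≤ (proj₁ 0<W) S≤0))))
    below : fromℕ 2 * ((1# - ε) * W * S) ≤ fromℕ 2 * P
    below = ≤-by (+-nonNegative (*-nonNegative (x≤y⇒0≤y-x ε≤1) (x≤y⇒0≤y-x upper))
                   (*-nonNegative (+-nonNegative 0≤ε (*-nonNegative 0≤ε 0≤ε)) 0≤P))
      (solve 4 (λ e P W S → con (+ 2) :* P := con (+ 2) :* ((con (+ 1) :- e) :* W :* S) :+
        ((con (+ 1) :- e) :* (e :* P :- con (+ 2) :* (W :* S :- P)) :+ (e :+ e :* e) :* P)) refl ε P W S)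
    above : fromℕ 2 * P ≤ fromℕ 2 * ((1# + ε) * W * S)
    above = ≤-by (+-nonNegative (*-nonNegative (+-nonNegative 0≤1 0≤ε) (x≤y⇒0≤y-x lower))
                   (*-nonNegative (*-nonNegative 0≤ε (x≤y⇒0≤y-x ε≤1)) 0≤P))
      (solve 4 (λ e P W S → con (+ 2) :* ((con (+ 1) :+ e) :* W :* S) := con (+ 2) :* P :+
        ((con (+ 1) :+ e) :* (e :* P :- con (+ 2) :* (P :- W :* S)) :+ (e :* (con (+ 1) :- e)) :* P)) refl ε P W S)

  -- The pointwise form of Chebyshev's inequality: if the scaled deviation `θ * (S - P * i)` has
  -- square at most 1, the relative error of S is at most ε/2 and `accurate-by` applies.
  inaccurate : ∀ {P S θ} → 0# < P → θ * (ε * P) ≈ fromℕ 2 * W →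
    ∀ k → miss (accurate? ε I) k (just (P / S)) ≤ (θ * θ) * ((S - P * i) * (S - P * i))
  inaccurate {P} {S} {θ} 0<P θεP k = miss-returned (accurate? ε I) k (P / S)
    (*-nonNegative (square-nonNegative θ) (square-nonNegative (S - P * i)))
    λ ¬accurate → ≰⇒≥ (¬accurate ∘ accurate)
    where
    z = θ * (S - P * i)
    z*εP : z * (ε * P) ≈ fromℕ 2 * (W * S - P)
    z*εP = trans (solve 3 (λ t y e → (t :* y) :* e := (t :* e) :* y) refl θ (S - P * i) (ε * P))
      (trans (*-congʳ θεP) (trans
        (solve 4 (λ W S P i → con (+ 2) :* W :* (S :- P :* i) := con (+ 2) :* (W :* S :- P :* (W :* i))) refl W S P i)
        (*-congˡ (+-congˡ (-‿cong (trans (*-congˡ W*i) (*-identityʳ P)))))))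
    -z*εP : - z * (ε * P) ≈ fromℕ 2 * (P - W * S)
    -z*εP = trans (solve 2 (λ z e → (:- z) :* e := :- (z :* e)) refl z (ε * P)) (trans (-‿cong z*εP)
      (solve 2 (λ X P → :- (con (+ 2) :* (X :- P)) := con (+ 2) :* (P :- X)) refl (W * S) P))
    scale : ∀ {x y} → x ≤ 1# → x * (ε * P) ≈ y → y ≤ ε * P
    scale {x} x≤1 eq = ≤-respˡ (trans (*-comm (ε * P) x) eq) (≤-respʳ (*-identityʳ (ε * P))
      (*-monoˡ-≤ (*-nonNegative (proj₁ 0<ε) (proj₁ 0<P)) x≤1))
    accurate : (θ * θ) * ((S - P * i) * (S - P * i)) ≤ 1# → Accurate ε I (P / S)
    accurate zz≤1 = accurate-by 0<P (scale (square-cancel-≤ 0≤1 z²≤1) z*εP) (scale (square-cancel-≤ 0≤1 -z²≤1) -z*εP)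
      where
      z²≤1 : z * z ≤ 1# * 1#
      z²≤1 = ≤-respʳ (sym (*-identityʳ 1#)) (≤-respˡ
        (solve 2 (λ t y → (t :* t) :* (y :* y) := (t :* y) :* (t :* y)) refl θ (S - P * i)) zz≤1)
      -z²≤1 : - z * - z ≤ 1# * 1#
      -z²≤1 = ≤-respˡ (solve 1 (λ z → z :* z := (:- z) :* (:- z)) refl z) z²≤1

  -- The potential scaled by θ² dominates the failure at the end; at the start only its last term,
  -- the variance bound, is left.
  estimate-miss : ∀ {k₀} (v : Vec (Fin n) k₀) m {θ} → 0# < fromℕ (pairs m) → θ * (ε * fromℕ (pairs m)) ≈ fromℕ 2 * W →
    EventuallyAtMost (miss (accurate? ε I)) v (estimate m 0 {k₀} 0#) ((θ * θ) * (fromℕ (pairs m) * (N * i * i)))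
  estimate-miss {k₀} v m {θ} 0<P θεP = eventually-≤ (≤-reflexive (*-congˡ
      (solve 4 (λ i m P N → (con (+ 0) :- con (+ 0) :* i) :* (con (+ 0) :- con (+ 0) :* i)
        :+ m :* ((con (+ 0) :- con (+ 0) :* con (+ 0) :* i) :* i) :+ P :* (N :* i :* i) := P :* (N :* i :* i)) refl
        i (fromℕ m) (fromℕ (pairs m)) N)))
    (estimate-eventually m (λ l j v S → (θ * θ) * potential {k₀} l j v S)
      (λ v S → ≤-respʳ (*-congˡ (final v S)) (inaccurate {S = S} 0<P θεP (m ℕ.+ k₀)))
      (λ l j v S wd → ≤-respˡ (factor l j v S) (*-monoˡ-≤ (square-nonNegative θ) (potential-step l j v S wd)))
      m 0 v 0# (ℕ.+-identityʳ m) λ ())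
    where
    final : ∀ (v : Vec (Fin n) (m ℕ.+ k₀)) S →
      (S - fromℕ (pairs m) * i) * (S - fromℕ (pairs m) * i) ≈ potential {k₀} 0 m v S
    final v S = solve 3 (λ Y e x → Y := Y :+ con (+ 0) :* e :+ con (+ 0) :* x) refl
      ((S - fromℕ (pairs m) * i) * (S - fromℕ (pairs m) * i)) ((energy (drawn m v) - fromℕ m * fromℕ m * i) * i) (N * i * i)
    factor : ∀ l j (v : Vec (Fin n) (j ℕ.+ k₀)) S →
      (θ * θ) * sum (λ a → p a * potential {k₀} l (suc j) (a ∷ v) (S + fromℕ (occurrences (drawn j v) a) * w a ⁻¹)) ≈
      sum (λ a → p a * ((θ * θ) * potential {k₀} l (suc j) (a ∷ v) (S + fromℕ (occurrences (drawn j v) a) * w a ⁻¹)))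
    factor l j v S = trans (*-distribˡ-sum {n} (θ * θ) _)
      (sum-cong-≋ {n} λ a → solve 3 (λ t p x → t :* (p :* x) := p :* (t :* x)) refl (θ * θ) (p a) _)

  pairs-square : ∀ m → fromℕ 2 * fromℕ (pairs m) + fromℕ m ≈ fromℕ m * fromℕ m
  pairs-square zero    = solve 0 (con (+ 2) :* con (+ 0) :+ con (+ 0) := con (+ 0) :* con (+ 0)) refl
  pairs-square (suc m) = begin
    fromℕ 2 * fromℕ (m ℕ.+ pairs m) + (1# + M)    ≈⟨ +-congʳ (*-congˡ (fromℕ-+ m (pairs m))) ⟩
    fromℕ 2 * (M + fromℕ (pairs m)) + (1# + M)    ≈⟨ solve 2 (λ M P → con (+ 2) :* (M :+ P) :+ (con (+ 1) :+ M) :=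
                                                       (con (+ 2) :* P :+ M) :+ (con (+ 2) :* M :+ con (+ 1))) refl M (fromℕ (pairs m)) ⟩
    (fromℕ 2 * fromℕ (pairs m) + M) + (fromℕ 2 * M + 1#)  ≈⟨ +-congʳ (pairs-square m) ⟩
    M * M + (fromℕ 2 * M + 1#)                    ≈⟨ solve 1 (λ M →
      M :* M :+ (con (+ 2) :* M :+ con (+ 1)) := (con (+ 1) :+ M) :* (con (+ 1) :+ M)) refl M ⟩
    (1# + M) * (1# + M)                           ∎
    where
    open ≈-Reasoning
    M = fromℕ m

  -- The total failure probability 1/3 is split as 1/12 for the estimate after enough uniform
  -- samples and 1/4 for too early a repetition.
  τ : Carrier
  τ = 1# / fromℕ 12

  τ*12≈1 : τ * fromℕ 12 ≈ 1#
  τ*12≈1 = x/y*y≈x (0<fromℕ-suc 11)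

  0≤τ : 0# ≤ τ
  0≤τ = *-nonNegative 0≤1 (⁻¹-nonNegative (0<fromℕ-suc 11))

  fromℕ-repetitions : ∀ K → fromℕ (repetitions ε K) ≈ fromℕ 28 * (fromℕ ⌈ε⁻¹⌉ * fromℕ K)
  fromℕ-repetitions K = trans (fromℕ-* 28 (⌈ε⁻¹⌉ ℕ.* K)) (*-congˡ (fromℕ-* ⌈ε⁻¹⌉ K))

  estimate-miss-≤τ : ∀ k (v : Vec (Fin n) (suc k)) → r ≤ fromℕ 2 * fromℕ (suc k) →
    EventuallyAtMost (miss (accurate? ε I)) v (estimate (repetitions ε (suc k)) 0 {suc k} 0#) τ
  estimate-miss-≤τ k v r≤2K = eventually-≤ (≤-/ (0<fromℕ-suc 11) (*-cancelˡ-≤ (*-positive 0<εP 0<εP) bound))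
    (estimate-miss v m 0<P (x/y*y≈x 0<εP))
    where
    m = repetitions ε (suc k)
    M = fromℕ m
    K = fromℕ (suc k)
    c = fromℕ ⌈ε⁻¹⌉
    P = fromℕ (pairs m)

    0≤M : 0# ≤ M
    0≤M = 0≤fromℕ m

    28K≤εM : fromℕ 28 * K ≤ ε * M
    28K≤εM = ≤-by (*-nonNegative (x≤y⇒0≤y-x 1≤ε*⌈ε⁻¹⌉) (*-nonNegative (0≤fromℕ 28) (0≤fromℕ (suc k))))
      (trans (*-congˡ (fromℕ-repetitions (suc k)))
        (solve 4 (λ e c K x → e :* (x :* (c :* K)) := x :* K :+ (e :* c :- con (+ 1)) :* (x :* K)) refl ε c K (fromℕ 28)))

    28K≤M : fromℕ 28 * K ≤ M
    28K≤M = ≤-trans 28K≤εM (≤-by (*-nonNegative (x≤y⇒0≤y-x ε≤1) 0≤M)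
      (solve 2 (λ e M → M := e :* M :+ (con (+ 1) :- e) :* M) refl ε M))

    2≤M : fromℕ 2 ≤ M
    2≤M = ≤-trans (≤-by (+-nonNegative (0≤fromℕ 26) (*-nonNegative (0≤fromℕ 28) (x≤y⇒0≤y-x (1≤fromℕ-suc k))))
      (solve 1 (λ K → con (+ 28) :* K := con (+ 2) :+ (con (+ 26) :+ con (+ 28) :* (K :- con (+ 1)))) refl K)) 28K≤M

    MM≤4P : M * M ≤ fromℕ 4 * P
    MM≤4P = ≤-by (*-nonNegative 0≤M (x≤y⇒0≤y-x 2≤M)) (begin
      fromℕ 4 * P                                     ≈⟨ solve 2 (λ P M → con (+ 4) :* P :=
                                                          con (+ 2) :* (con (+ 2) :* P :+ M) :- con (+ 2) :* M) refl P M ⟩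
      fromℕ 2 * (fromℕ 2 * P + M) - fromℕ 2 * M       ≈⟨ +-congʳ (*-congˡ (pairs-square m)) ⟩
      fromℕ 2 * (M * M) - fromℕ 2 * M                 ≈⟨ solve 1 (λ M → con (+ 2) :* (M :* M) :- con (+ 2) :* M :=
                                                          M :* M :+ M :* (M :- con (+ 2))) refl M ⟩
      M * M + M * (M - fromℕ 2)                       ∎)
      where open ≈-Reasoning

    0<P : 0# < P
    0<P = ≰⇒> λ P≤0 → <⇒≱ (*-positive 0<M 0<M) (≤-trans MM≤4P (≤-respʳ (zeroʳ (fromℕ 4)) (*-monoˡ-≤ (0≤fromℕ 4) P≤0)))
      where
      0<M : 0# < M
      0<M = <-≤-trans (0<fromℕ-suc 1) 2≤M

    0<εP : 0# < ε * P
    0<εP = *-positive 0<ε 0<P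

    -- Here 48 is 4 · 12: Chebyshev's bound is 4n / (ε² P) and has to be at most 1/12. It follows
    -- because 14² = 196 exceeds 4 · 48, the 4 coming from `MM≤4P`.
    48N≤εεP : fromℕ 48 * N ≤ ε * ε * P
    48N≤εεP = *-cancelˡ-≤ (0<fromℕ-suc 3) (begin
      fromℕ 4 * (fromℕ 48 * N)                 ≈⟨ *-congˡ (*-congˡ rr≈N) ⟨
      fromℕ 4 * (fromℕ 48 * (r * r))           ≤⟨ ≤-by (*-nonNegative (0≤fromℕ 4) (*-nonNegative 0≤r 0≤r))
        (solve 1 (λ r → (con (+ 14) :* r) :* (con (+ 14) :* r) :=
          con (+ 4) :* (con (+ 48) :* (r :* r)) :+ con (+ 4) :* (r :* r)) refl r) ⟩
      (fromℕ 14 * r) * (fromℕ 14 * r)          ≤⟨ *-mono-≤ 0≤14r 0≤14r 14r≤εM 14r≤εM ⟩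
      (ε * M) * (ε * M)                        ≈⟨ solve 2 (λ e M → (e :* M) :* (e :* M) := (e :* e) :* (M :* M)) refl ε M ⟩
      (ε * ε) * (M * M)                        ≤⟨ *-monoˡ-≤ (square-nonNegative ε) MM≤4P ⟩
      (ε * ε) * (fromℕ 4 * P)                  ≈⟨ solve 3 (λ e x P → (e :* e) :* (x :* P) := x :* (e :* e :* P)) refl
                                                    ε (fromℕ 4) P ⟩
      fromℕ 4 * (ε * ε * P)                    ∎)
      where
      open ≤-Reasoning
      0≤14r : 0# ≤ fromℕ 14 * r
      0≤14r = *-nonNegative (0≤fromℕ 14) 0≤r
      14r≤εM : fromℕ 14 * r ≤ ε * M
      14r≤εM = ≤-trans (≤-respʳ (solve 1 (λ K → con (+ 14) :* (con (+ 2) :* K) := con (+ 28) :* K) refl K)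
        (*-monoˡ-≤ (0≤fromℕ 14) r≤2K)) 28K≤εM

    -- The reciprocal of the tolerated deviation, which is ε/2 times the mean P / W.
    θ = (fromℕ 2 * W) / (ε * P)

    bound : ((ε * P) * (ε * P)) * (((θ * θ) * (P * (N * i * i))) * fromℕ 12) ≤ ((ε * P) * (ε * P)) * 1#
    bound = begin
      ((ε * P) * (ε * P)) * (((θ * θ) * (P * (N * i * i))) * fromℕ 12)
        ≈⟨ solve 6 (λ e t P N i x → (e :* e) :* (((t :* t) :* (P :* (N :* i :* i))) :* x) :=
             (t :* e) :* (t :* e) :* (P :* (N :* i :* i)) :* x) refl (ε * P) θ P N i (fromℕ 12) ⟩
      (θ * (ε * P)) * (θ * (ε * P)) * (P * (N * i * i)) * fromℕ 12
        ≈⟨ *-congʳ (*-congʳ (*-cong (x/y*y≈x 0<εP) (x/y*y≈x 0<εP))) ⟩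
      (fromℕ 2 * W) * (fromℕ 2 * W) * (P * (N * i * i)) * fromℕ 12
        ≈⟨ solve 4 (λ W P N i → (con (+ 2) :* W) :* (con (+ 2) :* W) :* (P :* (N :* i :* i)) :* con (+ 12) :=
             (W :* i) :* (W :* i) :* (P :* (con (+ 48) :* N))) refl W P N i ⟩
      (W * i) * (W * i) * (P * (fromℕ 48 * N))  ≈⟨ *-congʳ (trans (*-cong W*i W*i) (*-identityʳ 1#)) ⟩
      1# * (P * (fromℕ 48 * N))                 ≤⟨ *-monoˡ-≤ 0≤1 (*-monoˡ-≤ (proj₁ 0<P) 48N≤εεP) ⟩
      1# * (P * (ε * ε * P))
        ≈⟨ solve 2 (λ e P → con (+ 1) :* (P :* (e :* e :* P)) := ((e :* P) :* (e :* P)) :* con (+ 1)) refl ε P ⟩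
      ((ε * P) * (ε * P)) * 1#                  ∎
      where open ≤-Reasoning

  -- The whole run: termination, expected samples and failure probability.

  start-injective : ∀ {a b : Fin 0} → lookup {A = Fin n} [] a ≡ lookup [] b → a ≡ b
  start-injective {()}

  collide-from-start : ∀ {g} (f Ψ : ℕ → Carrier) →
    (∀ k (v : Vec (Fin n) (suc k)) → EventuallyAtMost g v (estimate (repetitions ε (suc k)) 0 {suc k} 0#) (f (suc k))) →
    (∀ d → fromℕ d * f (suc d) + (N - fromℕ d) * Ψ (suc d) ≤ N * Ψ d) →
    EventuallyAtMost g [] collide (Ψ 0)
  collide-from-start f Ψ stop rec = collide-eventually f Ψ stop rec (suc n) 0 [] (ℕ.+-identityʳ (suc n)) start-injective

  -- As a cut-off counts as a miss, the zero potential shows that from some cut-off on the run has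
  -- returned with probability 1.
  collide-terminates : EventuallyAtMost (miss {λ _ → ⊤} (λ _ → yes _)) [] collide 0#
  collide-terminates = collide-from-start (λ _ → 0#) (λ _ → 0#)
    (λ k v → estimate-returns v (repetitions ε (suc k)) λ _ _ → ≤-refl)
    (λ d → ≤-reflexive (solve 2 (λ d N → d :* con (+ 0) :+ (N :- d) :* con (+ 0) := N :* con (+ 0)) refl (fromℕ d) N))

  -- The total number of samples divided by K: each uniform sample entails 28 ⌈1/ε⌉ proportional
  -- ones.
  samplesPerRound : Carrier
  samplesPerRound = 1# + fromℕ 28 * fromℕ ⌈ε⁻¹⌉

  0≤samplesPerRound : 0# ≤ samplesPerRound
  0≤samplesPerRound = +-nonNegative 0≤1 (*-nonNegative (0≤fromℕ 28) (0≤fromℕ ⌈ε⁻¹⌉))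

  collide-samples : EventuallyAtMost (λ k _ → fromℕ k) [] collide (fromℕ 57 * fromℕ 3 * (r / ε))
  collide-samples = eventually-≤ total≤ (collide-from-start (λ K → D * fromℕ K) (λ d → D * Φ d) stop rec)
    where
    D = samplesPerRound

    -- Beyond r distinct items a draw repeats one with probability at least
    -- 1 / r, so about r further draws are expected.
    early late Φ : ℕ → Carrier
    early d = fromℕ 2 * r + 1#
    late d  = r + fromℕ d
    Φ d     = early d ⊔ late d

    stop : ∀ k (v : Vec (Fin n) (suc k)) → EventuallyAtMost (λ k _ → fromℕ k) v
             (estimate (repetitions ε (suc k)) 0 {suc k} 0#) (D * fromℕ (suc k))
    stop k v = eventually-≤ (≤-reflexive (trans (fromℕ-+ (repetitions ε (suc k)) (suc k))
        (trans (+-congʳ (fromℕ-repetitions (suc k)))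
        (solve 3 (λ x c K → x :* (c :* K) :+ K := (con (+ 1) :+ x :* c) :* K) refl (fromℕ 28) (fromℕ ⌈ε⁻¹⌉) (fromℕ (suc k))))))
      (estimate-samples v (repetitions ε (suc k)))

    early-step : ∀ d → late (suc d) ≤ early d → fromℕ d * fromℕ (suc d) + (N - fromℕ d) * early d ≤ N * early d
    early-step d l≤e = ≤-by (*-nonNegative (0≤fromℕ d) (+-nonNegative 0≤r (x≤y⇒0≤y-x l≤e)))
      (solve 3 (λ N r δ → N :* (con (+ 2) :* r :+ con (+ 1)) :=
        (δ :* (con (+ 1) :+ δ) :+ (N :- δ) :* (con (+ 2) :* r :+ con (+ 1)))
          :+ δ :* (r :+ ((con (+ 2) :* r :+ con (+ 1)) :- (r :+ (con (+ 1) :+ δ))))) refl N r (fromℕ d))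

    late-step : ∀ d → early d ≤ late (suc d) → fromℕ d * fromℕ (suc d) + (N - fromℕ d) * late (suc d) ≤ N * late d
    late-step d e≤l = begin
      δ * (1# + δ) + (N - δ) * (r + (1# + δ))   ≈⟨ solve 3 (λ N r δ →
        δ :* (con (+ 1) :+ δ) :+ (N :- δ) :* (r :+ (con (+ 1) :+ δ)) := N :* (r :+ δ) :+ (N :- δ :* r)) refl N r δ ⟩
      -- The excess is r (r - d), which is nonpositive because `e≤l` amounts to r ≤ d.
      N * (r + δ) + (N - δ * r)                 ≈⟨ +-congˡ (+-congʳ rr≈N) ⟨
      N * (r + δ) + (r * r - δ * r)             ≤⟨ ≤-by (*-nonNegative 0≤r (x≤y⇒0≤y-x e≤l))
        (solve 3 (λ X r δ → X := (X :+ (r :* r :- δ :* r))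
          :+ r :* ((r :+ (con (+ 1) :+ δ)) :- (con (+ 2) :* r :+ con (+ 1)))) refl (N * (r + δ)) r δ) ⟩
      N * (r + δ)                               ∎
      where
      open ≤-Reasoning
      δ = fromℕ d

    rec′ : ∀ d → fromℕ d * fromℕ (suc d) + (N - fromℕ d) * Φ (suc d) ≤ N * Φ d
    rec′ d = [ rec-late , rec-early ]′ (total (early (suc d)) (late (suc d)))
      where
      rec-early : late (suc d) ≤ early (suc d) → fromℕ d * fromℕ (suc d) + (N - fromℕ d) * Φ (suc d) ≤ N * Φ d
      rec-early l≤e = ≤-respˡ (+-congˡ (*-congˡ (sym (y≤x⇒x⊔y≈x l≤e))))
        (≤-trans (early-step d l≤e) (*-monoˡ-≤ {N} {early d} {Φ d} (0≤fromℕ n) (x≤x⊔y (early d) (late d))))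
      rec-late : early (suc d) ≤ late (suc d) → fromℕ d * fromℕ (suc d) + (N - fromℕ d) * Φ (suc d) ≤ N * Φ d
      rec-late e≤l = ≤-respˡ (+-congˡ (*-congˡ (sym (x≤y⇒x⊔y≈y e≤l))))
        (≤-trans (late-step d e≤l) (*-monoˡ-≤ {N} {late d} {Φ d} (0≤fromℕ n) (y≤x⊔y (early d) (late d))))

    rec : ∀ d → fromℕ d * (D * fromℕ (suc d)) + (N - fromℕ d) * (D * Φ (suc d)) ≤ N * (D * Φ d)
    rec d = ≤-respˡ
      (solve 5 (λ D δ N K φ → D :* (δ :* K :+ (N :- δ) :* φ) := δ :* (D :* K) :+ (N :- δ) :* (D :* φ)) refl
        D (fromℕ d) N (fromℕ (suc d)) (Φ (suc d)))
      (≤-respʳ (solve 3 (λ D N φ → D :* (N :* φ) := N :* (D :* φ)) refl D N (Φ d))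
        (*-monoˡ-≤ 0≤samplesPerRound (rec′ d)))

    -- 57 = 1 + 28 · 2, as 1 ≤ 1/ε and ⌈1/ε⌉ ≤ 2/ε.
    D≤57ε⁻¹ : D ≤ fromℕ 57 * ε ⁻¹
    D≤57ε⁻¹ = ≤-by (+-nonNegative (x≤y⇒0≤y-x 1≤ε⁻¹) (*-nonNegative (0≤fromℕ 28) (x≤y⇒0≤y-x ⌈ε⁻¹⌉≤2ε⁻¹)))
      (solve 2 (λ e c → con (+ 57) :* e := con (+ 1) :+ con (+ 28) :* c :+
        (e :- con (+ 1) :+ con (+ 28) :* (con (+ 2) :* e :- c))) refl (ε ⁻¹) (fromℕ ⌈ε⁻¹⌉))

    Φ₀≤3r : Φ 0 ≤ fromℕ 3 * r
    Φ₀≤3r = ⊔-lub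
      (≤-by (x≤y⇒0≤y-x 1≤r) (solve 1 (λ r → con (+ 3) :* r := con (+ 2) :* r :+ con (+ 1) :+ (r :- con (+ 1))) refl r))
      (≤-by (*-nonNegative (0≤fromℕ 2) 0≤r) (solve 1 (λ r → con (+ 3) :* r := r :+ con (+ 0) :+ con (+ 2) :* r) refl r))

    total≤ : D * Φ 0 ≤ fromℕ 57 * fromℕ 3 * (r / ε)
    total≤ = ≤-respʳ
      (solve 4 (λ x y e r → (x :* e) :* (y :* r) := x :* y :* (r :* e)) refl (fromℕ 57) (fromℕ 3) (ε ⁻¹) r)
      (*-mono-≤ 0≤samplesPerRound
        (≤-trans (*-nonNegative (0≤fromℕ 2) 0≤r) (≤-trans (≤-by 0≤1 refl) (x≤x⊔y (early 0) (late 0))))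
        D≤57ε⁻¹ Φ₀≤3r)

  collide-miss : EventuallyAtMost (miss (accurate? ε I)) [] collide (1# / fromℕ 3)
  collide-miss = eventually-≤ (≤-/ (0<fromℕ-suc 2) (*-cancelˡ-≤ (0<fromℕ-suc 3) Ψ₀≤1/3)) (collide-from-start f Ψ stop rec)
    where
    β : Carrier
    β = 1# / (fromℕ 4 * r)

    0<4r : 0# < fromℕ 4 * r
    0<4r = *-positive (0<fromℕ-suc 3) (<-≤-trans 0<1 1≤r)

    0≤β : 0# ≤ β
    0≤β = *-nonNegative 0≤1 (⁻¹-nonNegative 0<4r)

    4Nβ≈r : fromℕ 4 * N * β ≈ r
    4Nβ≈r = trans (*-congʳ (*-congˡ (sym rr≈N))) (trans
      (solve 3 (λ x r β → x :* (r :* r) :* β := r :* (β :* (x :* r))) refl (fromℕ 4) r β)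
      (trans (*-congˡ (x/y*y≈x 0<4r)) (*-identityʳ r)))

    deficit : ℕ → Carrier
    deficit d = r - fromℕ 2 * fromℕ d

    enough? : ∀ d → Dec (r ≤ fromℕ 2 * fromℕ d)
    enough? d = r ≤? fromℕ 2 * fromℕ d

    -- Until 2d reaches r, each draw repeats an item with probability at most
    -- 1 / (2r), that is 2β; afterwards the estimate fails with probability τ.
    f Ψ : ℕ → Carrier
    f d = if does (enough? d) then τ else 1#
    Ψ d = τ + (0# ⊔ deficit d) * β

    0≤Ψ-τ : ∀ d → 0# ≤ (0# ⊔ deficit d) * β
    0≤Ψ-τ d = *-nonNegative (x≤x⊔y 0# (deficit d)) 0≤β

    stop : ∀ k (v : Vec (Fin n) (suc k)) →
      EventuallyAtMost (miss (accurate? ε I)) v (estimate (repetitions ε (suc k)) 0 {suc k} 0#) (f (suc k))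
    stop k v = if-does (enough? (suc k)) (EventuallyAtMost (miss (accurate? ε I)) v (estimate (repetitions ε (suc k)) 0 {suc k} 0#))
      (estimate-miss-≤τ k v) (λ _ → estimate-returns v (repetitions ε (suc k)) λ k x → miss≤1 (accurate? ε I) k (just x))

    rec : ∀ d → fromℕ d * f (suc d) + (N - fromℕ d) * Ψ (suc d) ≤ N * Ψ d
    rec d = if-does (enough? (suc d)) (λ z → fromℕ d * z + (N - fromℕ d) * Ψ (suc d) ≤ N * Ψ d) rec-enough rec-few
      where
      rec-enough : r ≤ fromℕ 2 * fromℕ (suc d) → fromℕ d * τ + (N - fromℕ d) * Ψ (suc d) ≤ N * Ψ d
      rec-enough r≤ = ≤-respˡ (+-congˡ (*-congˡ (sym Ψ′≈τ))) (≤-by (*-nonNegative (0≤fromℕ n) (0≤Ψ-τ d))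
        (solve 4 (λ N δ τ x → N :* (τ :+ x) := (δ :* τ :+ (N :- δ) :* τ) :+ N :* x) refl N (fromℕ d) τ ((0# ⊔ deficit d) * β)))
        where
        deficit≤0 : deficit (suc d) ≤ 0#
        deficit≤0 = ≤-by (x≤y⇒0≤y-x r≤) (solve 2 (λ x y → con (+ 0) := (x :- y) :+ (y :- x)) refl r (fromℕ 2 * fromℕ (suc d)))
        Ψ′≈τ : Ψ (suc d) ≈ τ
        Ψ′≈τ = trans (+-congˡ (trans (*-congʳ (y≤x⇒x⊔y≈x deficit≤0)) (zeroˡ β))) (+-identityʳ τ)

      rec-few : ¬ (r ≤ fromℕ 2 * fromℕ (suc d)) → fromℕ d * 1# + (N - fromℕ d) * Ψ (suc d) ≤ N * Ψ d
      rec-few r≰ = ≤-respˡ (+-congˡ (*-congˡ (+-congˡ (*-congʳ (sym (x≤y⇒x⊔y≈y 0≤deficit))))))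
        (≤-trans (*-cancelˡ-≤ (0<fromℕ-suc 1) linear)
          (*-monoˡ-≤ (0≤fromℕ n) (+-mono-≤ ≤-refl
            (≤-respˡ (*-comm β _) (≤-respʳ (*-comm β _) (*-monoˡ-≤ 0≤β (y≤x⊔y 0# (deficit d))))))))
        where
        δ = fromℕ d
        0≤deficit : 0# ≤ deficit (suc d)
        0≤deficit = x≤y⇒0≤y-x (≰⇒≥ r≰)
        -- A draw lowers the deficit by 2, which frees 2 N β = r / 2; this pays for the at most `δ`
        -- repeated outcomes, as 2 d is still below r.
        linear : fromℕ 2 * (δ * 1# + (N - δ) * (τ + deficit (suc d) * β)) ≤ fromℕ 2 * (N * (τ + deficit d * β))
        linear = ≤-by
          (+-nonNegative (+-nonNegative 0≤deficit (0≤fromℕ 2))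
            (*-nonNegative (*-nonNegative (0≤fromℕ 2) (0≤fromℕ d)) (+-nonNegative 0≤τ (*-nonNegative 0≤deficit 0≤β))))
          (trans
            (solve 5 (λ N δ τ r β →
              con (+ 2) :* (N :* (τ :+ (r :- con (+ 2) :* δ) :* β)) :=
              con (+ 2) :* (δ :* con (+ 1) :+ (N :- δ) :* (τ :+ (r :- con (+ 2) :* (con (+ 1) :+ δ)) :* β))
              :+ (con (+ 4) :* N :* β :- con (+ 2) :* (con (+ 1) :+ δ) :+ con (+ 2)
                :+ con (+ 2) :* δ :* (τ :+ (r :- con (+ 2) :* (con (+ 1) :+ δ)) :* β))) refl N δ τ r β)
            (+-congˡ (+-congʳ (+-congʳ (+-congʳ 4Nβ≈r)))))

    -- The initial potential is 1/12 + r β = 1/12 + 1/4; everything is multiplied by 12 to clear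
    -- denominators.
    Ψ₀≤1/3 : fromℕ 4 * (Ψ 0 * fromℕ 3) ≤ fromℕ 4 * 1#
    Ψ₀≤1/3 = ≤-reflexive (begin
      fromℕ 4 * (Ψ 0 * fromℕ 3)     ≈⟨ *-congˡ (*-congʳ (+-congˡ (*-congʳ (x≤y⇒x⊔y≈y 0≤deficit₀)))) ⟩
      fromℕ 4 * ((τ + deficit 0 * β) * fromℕ 3)     ≈⟨ solve 3 (λ τ r β →
        con (+ 4) :* ((τ :+ (r :- con (+ 2) :* con (+ 0)) :* β) :* con (+ 3)) :=
        τ :* con (+ 12) :+ con (+ 3) :* (β :* (con (+ 4) :* r))) refl τ r β ⟩
      τ * fromℕ 12 + fromℕ 3 * (β * (fromℕ 4 * r))  ≈⟨ +-cong τ*12≈1 (*-congˡ (x/y*y≈x 0<4r)) ⟩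
      1# + fromℕ 3 * 1#                             ≈⟨ solve 0 (con (+ 1) :+ con (+ 3) :* con (+ 1) := con (+ 4) :* con (+ 1)) refl ⟩
      fromℕ 4 * 1#                                  ∎)
      where
      open ≈-Reasoning
      0≤deficit₀ : 0# ≤ deficit 0
      0≤deficit₀ = ≤-respʳ (solve 1 (λ r → r := r :- con (+ 2) :* con (+ 0)) refl r) 0≤r

  -- Passage to suprema over cut-offs.

  sup-exists : ∀ (s : ℕ → Carrier) {b} → (∀ t → s t ≤ b) → ∃[ x ] IsSup s x × x ≤ b
  sup-exists s {b} s≤b =
    let x , isLub = complete (λ x → ∃[ t ] x ≈ s t) (s 0 , 0 , refl) (b , bound)
    in x , isLub , proj₂ isLub b bound
    where
    bound : UpperBound (λ x → ∃[ t ] x ≈ s t) b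
    bound (t , x≈st) = ≤-respˡ (sym x≈st) (s≤b t)

  -- A single late cut-off is enough, since a value attained there bounds the supremum from below.
  indicator-≥ : ∀ {P : Pred Carrier 0ℓ} (P? : Decidable P) {b} → EventuallyAtMost (miss P?) [] collide b →
    ∃[ t ] 1# - b ≤ expect (indicator P?) t [] collide
  indicator-≥ P? {b} (T , ev) = T , ≤-by (x≤y⇒0≤y-x (ev T ℕ.≤-refl)) (sym (trans
    (solve 3 (λ o b m → (o :- b) :+ (b :- m) := o :- m) refl 1# b _)
    (trans (+-congʳ (sym (expect-complement (indicator+miss P?) T [] collide)))
      (solve 2 (λ i m → (i :+ m) :- m := i) refl _ _))))

  terminates : TerminatesAlmostSurely
  terminates = (λ { (t , x≈) → ≤-respˡ (sym x≈) (expect-≤-const (indicator≤1 {λ _ → ⊤} (λ _ → yes _)) t [] collide) })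
    , λ u upper → let t , 1-0≤ = indicator-≥ {λ _ → ⊤} (λ _ → yes _) collide-terminates
                  in ≤-trans (≤-respˡ (solve 0 (con (+ 1) :- con (+ 0) := con (+ 1)) refl) 1-0≤) (upper (t , refl))

  expected-samples : ∃[ e ] ExpectedSamples e × e ≤ fromℕ 57 * fromℕ 3 * (r / ε)
  expected-samples = sup-exists _ λ t → ≤-trans
    -- The bound is known from cut-off `T` on; an earlier cut-off is first raised to `t ⊔ T` by
    -- monotonicity.
    (expect-increasing (λ _ _ → ≤-refl) (λ k → ≤-by 0≤1 (+-comm 1# (fromℕ k))) (ℕ.m≤m⊔n t T) [] collide)
    (proj₂ collide-samples (t ℕ.⊔ T) (ℕ.m≤n⊔m t T))
    where
    T = proj₁ collide-samples

  success-probability : ∃[ x ] ProbReturns (accurate? ε I) x × fromℕ 2 / fromℕ 3 ≤ x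
  success-probability =
    let x , isSup , _ = sup-exists _ λ t → expect-≤-const (indicator≤1 (accurate? ε I)) t [] collide
        t , 2/3≤      = indicator-≥ (accurate? ε I) collide-miss
    in x , isSup , ≤-trans (≤-reflexive 2/3≈) (≤-trans 2/3≤ (proj₁ isSup (t , refl)))
    where
    third : Carrier
    third = fromℕ 3 ⁻¹
    2/3≈ : fromℕ 2 * third ≈ 1# - 1# * third
    2/3≈ = trans (solve 1 (λ x → con (+ 2) :* x := con (+ 3) :* x :- con (+ 1) :* x) refl third)
      (+-congʳ (⁻¹-inverseʳ (<⇒≉ (0<fromℕ-suc 2))))

theorem11 : (ℝ : Reals) →
    let open Reals ℝ
        open Hybrid ℝ
        open Instance
        open Run
    in
    Σ[ C ∈ Carrier ] Σ[ A ∈ (Carrier → Algorithm) ]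
      (∀ ε → 0# < ε → ε < 1# →
       ∀ (I : Instance) → 1 ≤ℕ size I → 0# < W I →
         TerminatesAlmostSurely (A ε) I
         × (∃[ e ] ∃[ r ] ExpectedSamples (A ε) I e
              × IsSqrt (fromℕ (size I)) r
              × e ≤ C * (r / ε))
         × (∃[ p ] ProbReturns (A ε) I (accurate? ε I) p
              × fromℕ 2 / fromℕ 3 ≤ p))
theorem11 ℝ = fromℕ 57 * fromℕ 3 , algorithm , λ ε 0<ε ε<1 I 1≤n 0<W →
  let open Bounds ℝ ε 0<ε ε<1 I 1≤n 0<W
      e , isExpectation , e≤ = expected-samples
  in terminates , (e , r , isExpectation , proj₁ (proj₂ root) , e≤) , success-probability
  where
  open Reals ℝ
  open CollisionEstimator ℝ
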